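{- For all positive integers $n$, one can construct a graph $G_n$ with $n$ vertices such that the extension complexity of the stable set polytope $\mathrm{STAB}(G_n)$ is $2^{\Omega(\sqrt{n})}$.
   Context: Graphs are finite, simple and undirected. A stable set of a graph $G=(V,E)$ is a subset of $V$ no two elements of which are adjacent. For $S\subseteq V$, $\chi^S\in\mathbb{R}^V$ is the characteristic vector of $S$. The stable set polytope is $\mathrm{STAB}(G)=\operatorname{conv}\{\chi^S\in\mathbb{R}^V\mid S \text{ is a stable set of } G\}$. An extended formulation (EF) of a polytope $P \subseteq \mathbb{R}^d$ is a linear system $E^{=}x + F^{=}y = g^{=},\ E^{\leqslant}x + F^{\leqslant}y \leqslant g^{\leqslant}$ in variables $(x,y)\in\mathbb{R}^{d+k}$ (for some $k \geqslant 0$), with real matrices and real vectors as coefficients, such that $x\in P$ if and only if there exists $y\in\mathbb{R}^k$ such that $(x,y)$ satisfies the system. The size of an EF is its number of inequalities (equalities are not counted). The extension complexity of $P$ is the minimum size of an EF of $P$. "The extension complexity of $\mathrm{STAB}(G_n)$ is $2^{\Omega(\sqrt n)}$" means: there is a constant $c>0$, independent of $n$, such that it is at least $2^{c\sqrt n}$ for all sufficiently large $n$. -}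

module Defs where

open import Data.Bool.Base using (if_then_else_)
open import Data.Fin.Base using (Fin)
open import Data.Fin.Subset using (Subset; _∈_)
open import Data.Integer.Base as ℤ using (+_; +[1+_])
import Data.Integer.Properties as ℤ
open import Data.Nat.Base as ℕ using (ℕ; zero; suc; NonZero; z≤n; s≤s)
import Data.Nat.Properties as ℕ
open import Data.Nat.Tactic.RingSolver using (solve-∀)
open import Data.Product.Base using (Σ-syntax; ∃-syntax; _×_; _,_)
open import Data.Rational.Base as ℚ
  using (ℚ; mkℚ; 0ℚ; 1ℚ; ½; ∣_∣; *<*; nonNegative; positive)
import Data.Rational.Properties as ℚ
open import Data.Rational.Solver using (module +-*-Solver)
open import Data.Rational.Unnormalised.Base as ℚᵘ using (mkℚᵘ; *≤*)
import Data.Rational.Unnormalised.Properties as ℚᵘ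
open import Data.Sum.Base using (inj₁; inj₂)
open import Data.Vec.Base using (lookup)
open import Data.Vec.Functional as Vector using (Vector)
open import Function.Bundles using (_⇔_)
open import Level using (0ℓ)
open import Relation.Binary.Core using (Rel)
open import Relation.Binary.Definitions using (Decidable; Symmetric; Irreflexive)
open import Relation.Binary.PropositionalEquality
  using (_≡_; refl; sym; trans; cong; cong₂; subst; subst₂)
open import Relation.Nullary using (¬_; yes; no)
open import Relation.Unary using (Pred)

-- Cauchy sequences of rationals; equality of reals is _≈_, not _≡_.
record ℝ : Set where
  constructor mkℝ
  field
    seq    : ℕ → ℚ
    cauchy : ∀ ε → 0ℚ ℚ.< ε →
             ∃[ N ] ∀ m n → N ℕ.≤ m → N ℕ.≤ n → ∣ seq m ℚ.- seq n ∣ ℚ.≤ ε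

open ℝ public

infix 4 _≤_ _<_ _≈_

record _≤_ (x y : ℝ) : Set where
  constructor mk≤
  field
    eventually-≤ : ∀ ε → 0ℚ ℚ.< ε → ∃[ N ] ∀ n → N ℕ.≤ n → seq x n ℚ.≤ seq y n ℚ.+ ε

open _≤_ public

record _<_ (x y : ℝ) : Set where
  constructor mk<
  field
    gap          : ℚ
    gap-pos      : 0ℚ ℚ.< gap
    eventually-< : ∃[ N ] ∀ n → N ℕ.≤ n → seq x n ℚ.+ gap ℚ.≤ seq y n

open _<_ public

_≈_ : Rel ℝ 0ℓ
x ≈ y = x ≤ y × y ≤ x

private
  refl-close : ∀ q → ∣ q ℚ.- q ∣ ≡ 0ℚ
  refl-close q = cong ∣_∣ (ℚ.+-inverseʳ q)

  ½-pos : ∀ {ε} → 0ℚ ℚ.< ε → 0ℚ ℚ.< ½ ℚ.* ε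
  ½-pos {ε} 0<ε = subst (ℚ._< ½ ℚ.* ε) (ℚ.*-zeroʳ ½) (ℚ.*-monoʳ-<-pos ½ 0<ε)

  halves : ∀ ε → ½ ℚ.* ε ℚ.+ ½ ℚ.* ε ≡ ε
  halves ε = trans (sym (ℚ.*-distribʳ-+ ε ½ ½)) (ℚ.*-identityˡ ε)

fromℚ : ℚ → ℝ
fromℚ q = mkℝ (λ _ → q)
  λ ε 0<ε → 0 , λ _ _ _ _ → subst (ℚ._≤ ε) (sym (refl-close q)) (ℚ.<⇒≤ 0<ε)

0ℝ 1ℝ : ℝ
0ℝ = fromℚ 0ℚ
1ℝ = fromℚ 1ℚ

infixl 6 _+_
infixl 7 _*_

private abstract
  module _ (x y : ℝ) where

    +-cauchy : ∀ ε → 0ℚ ℚ.< ε →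
               ∃[ N ] ∀ m n → N ℕ.≤ m → N ℕ.≤ n →
               ∣ (seq x m ℚ.+ seq y m) ℚ.- (seq x n ℚ.+ seq y n) ∣ ℚ.≤ ε
    +-cauchy ε 0<ε with cauchy x (½ ℚ.* ε) (½-pos 0<ε) | cauchy y (½ ℚ.* ε) (½-pos 0<ε)
    ... | M , p | N , q = M ℕ.⊔ N , λ m n M⊔N≤m M⊔N≤n → begin
      ∣ (seq x m ℚ.+ seq y m) ℚ.- (seq x n ℚ.+ seq y n) ∣
        ≡⟨ cong ∣_∣ (rearrange (seq x m) (seq y m) (seq x n) (seq y n)) ⟩
      ∣ (seq x m ℚ.- seq x n) ℚ.+ (seq y m ℚ.- seq y n) ∣
        ≤⟨ ℚ.∣p+q∣≤∣p∣+∣q∣ (seq x m ℚ.- seq x n) (seq y m ℚ.- seq y n) ⟩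
      ∣ seq x m ℚ.- seq x n ∣ ℚ.+ ∣ seq y m ℚ.- seq y n ∣
        ≤⟨ ℚ.+-mono-≤
             (p m n (ℕ.m⊔n≤o⇒m≤o M N M⊔N≤m) (ℕ.m⊔n≤o⇒m≤o M N M⊔N≤n))
             (q m n (ℕ.m⊔n≤o⇒n≤o M N M⊔N≤m) (ℕ.m⊔n≤o⇒n≤o M N M⊔N≤n)) ⟩
      ½ ℚ.* ε ℚ.+ ½ ℚ.* ε
        ≡⟨ halves ε ⟩
      ε ∎
      where
      open ℚ.≤-Reasoning
      open +-*-Solver
      rearrange : ∀ a b c d → (a ℚ.+ b) ℚ.- (c ℚ.+ d) ≡ (a ℚ.- c) ℚ.+ (b ℚ.- d)
      rearrange = solve 4 (λ a b c d → (a :+ b) :- (c :+ d) := (a :- c) :+ (b :- d)) refl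

  0<1 : 0ℚ ℚ.< 1ℚ
  0<1 = *<* (ℤ.+<+ (s≤s z≤n))

  bounded : ∀ (x : ℝ) → ∃[ B ] 0ℚ ℚ.< B × ∃[ N ] ∀ n → N ℕ.≤ n → ∣ seq x n ∣ ℚ.≤ B
  bounded x with cauchy x 1ℚ 0<1
  ... | N , p = 1ℚ ℚ.+ ∣ seq x N ∣
              , ℚ.+-mono-<-≤ {0ℚ} {1ℚ} {0ℚ} 0<1 (ℚ.0≤∣p∣ (seq x N))
              , N , λ n N≤n → begin
    ∣ seq x n ∣
      ≡⟨ cong ∣_∣ (split (seq x n) (seq x N)) ⟩
    ∣ (seq x n ℚ.- seq x N) ℚ.+ seq x N ∣
      ≤⟨ ℚ.∣p+q∣≤∣p∣+∣q∣ (seq x n ℚ.- seq x N) (seq x N) ⟩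
    ∣ seq x n ℚ.- seq x N ∣ ℚ.+ ∣ seq x N ∣
      ≤⟨ ℚ.+-monoˡ-≤ ∣ seq x N ∣ (p n N N≤n ℕ.≤-refl) ⟩
    1ℚ ℚ.+ ∣ seq x N ∣ ∎
    where
    open ℚ.≤-Reasoning
    open +-*-Solver
    split : ∀ a b → a ≡ (a ℚ.- b) ℚ.+ b
    split = solve 2 (λ a b → a := (a :- b) :+ b) refl

  *-mono-≤ : ∀ {p q r s} → 0ℚ ℚ.≤ q → 0ℚ ℚ.≤ r → p ℚ.≤ q → r ℚ.≤ s → p ℚ.* r ℚ.≤ q ℚ.* s
  *-mono-≤ {q = q} {r} 0≤q 0≤r p≤q r≤s =
    ℚ.≤-trans (ℚ.*-monoʳ-≤-nonNeg r {{nonNegative 0≤r}} p≤q)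
              (ℚ.*-monoˡ-≤-nonNeg q {{nonNegative 0≤q}} r≤s)

  ∣ab-cd∣≤ : ∀ a b c d {A B δ} → 0ℚ ℚ.≤ A → 0ℚ ℚ.≤ B →
              ∣ a ∣ ℚ.≤ A → ∣ d ∣ ℚ.≤ B → ∣ a ℚ.- c ∣ ℚ.≤ δ → ∣ b ℚ.- d ∣ ℚ.≤ δ →
              ∣ a ℚ.* b ℚ.- c ℚ.* d ∣ ℚ.≤ A ℚ.* δ ℚ.+ B ℚ.* δ
  ∣ab-cd∣≤ a b c d {A} {B} {δ} 0≤A 0≤B ∣a∣≤A ∣d∣≤B ∣a-c∣≤δ ∣b-d∣≤δ = begin
    ∣ a ℚ.* b ℚ.- c ℚ.* d ∣
      ≡⟨ cong ∣_∣ (rearrange a b c d) ⟩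
    ∣ a ℚ.* (b ℚ.- d) ℚ.+ d ℚ.* (a ℚ.- c) ∣
      ≤⟨ ℚ.∣p+q∣≤∣p∣+∣q∣ (a ℚ.* (b ℚ.- d)) (d ℚ.* (a ℚ.- c)) ⟩
    ∣ a ℚ.* (b ℚ.- d) ∣ ℚ.+ ∣ d ℚ.* (a ℚ.- c) ∣
      ≡⟨ cong₂ ℚ._+_ (ℚ.∣p*q∣≡∣p∣*∣q∣ a (b ℚ.- d)) (ℚ.∣p*q∣≡∣p∣*∣q∣ d (a ℚ.- c)) ⟩
    ∣ a ∣ ℚ.* ∣ b ℚ.- d ∣ ℚ.+ ∣ d ∣ ℚ.* ∣ a ℚ.- c ∣
      ≤⟨ ℚ.+-mono-≤ (*-mono-≤ 0≤A (ℚ.0≤∣p∣ (b ℚ.- d)) ∣a∣≤A ∣b-d∣≤δ)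
                    (*-mono-≤ 0≤B (ℚ.0≤∣p∣ (a ℚ.- c)) ∣d∣≤B ∣a-c∣≤δ) ⟩
    A ℚ.* δ ℚ.+ B ℚ.* δ ∎
    where
    open ℚ.≤-Reasoning
    open +-*-Solver
    rearrange : ∀ a b c d → a ℚ.* b ℚ.- c ℚ.* d ≡ a ℚ.* (b ℚ.- d) ℚ.+ d ℚ.* (a ℚ.- c)
    rearrange = solve 4 (λ a b c d → a :* b :- c :* d := a :* (b :- d) :+ d :* (a :- c)) refl

  divide : ∀ B ε → 0ℚ ℚ.< B → 0ℚ ℚ.< ε → ∃[ δ ] 0ℚ ℚ.< δ × B ℚ.* δ ≡ ε
  divide B ε 0<B 0<ε = 1/B ℚ.* ε
    , subst (ℚ._< 1/B ℚ.* ε) (ℚ.*-zeroʳ 1/B) (ℚ.*-monoʳ-<-pos 1/B {{1/B-pos}} 0<ε)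
    , trans (sym (ℚ.*-assoc B 1/B ε))
     (trans (cong (ℚ._* ε) (ℚ.*-inverseʳ B {{B≢0}})) (ℚ.*-identityˡ ε))
    where
    B≢0 : ℚ.NonZero B
    B≢0 = ℚ.pos⇒nonZero B {{positive 0<B}}
    1/B : ℚ
    1/B = ℚ.1/_ B {{B≢0}}
    1/B-pos : ℚ.Positive 1/B
    1/B-pos = ℚ.1/pos⇒pos B {{positive 0<B}}

  module _ (x y : ℝ) where

    *-cauchy : ∀ ε → 0ℚ ℚ.< ε →
               ∃[ N ] ∀ m n → N ℕ.≤ m → N ℕ.≤ n →
               ∣ (seq x m ℚ.* seq y m) ℚ.- (seq x n ℚ.* seq y n) ∣ ℚ.≤ ε
    *-cauchy ε 0<ε =
      let
        A , 0<A , K , a = bounded x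
        B , 0<B , L , b = bounded y
        δ , 0<δ , [A+B]δ≡ε = divide (A ℚ.+ B) ε (ℚ.+-mono-< 0<A 0<B) 0<ε
        M , p = cauchy x δ 0<δ
        N , q = cauchy y δ 0<δ
      in (K ℕ.⊔ L) ℕ.⊔ (M ℕ.⊔ N) , λ m n h k →
        let
          KL≤m = ℕ.m⊔n≤o⇒m≤o (K ℕ.⊔ L) (M ℕ.⊔ N) h
          KL≤n = ℕ.m⊔n≤o⇒m≤o (K ℕ.⊔ L) (M ℕ.⊔ N) k
          MN≤m = ℕ.m⊔n≤o⇒n≤o (K ℕ.⊔ L) (M ℕ.⊔ N) h
          MN≤n = ℕ.m⊔n≤o⇒n≤o (K ℕ.⊔ L) (M ℕ.⊔ N) k
        in ℚ.≤-trans
             (∣ab-cd∣≤ (seq x m) (seq y m) (seq x n) (seq y n) (ℚ.<⇒≤ 0<A) (ℚ.<⇒≤ 0<B)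
               (a m (ℕ.m⊔n≤o⇒m≤o K L KL≤m)) (b n (ℕ.m⊔n≤o⇒n≤o K L KL≤n))
               (p m n (ℕ.m⊔n≤o⇒m≤o M N MN≤m) (ℕ.m⊔n≤o⇒m≤o M N MN≤n))
               (q m n (ℕ.m⊔n≤o⇒n≤o M N MN≤m) (ℕ.m⊔n≤o⇒n≤o M N MN≤n)))
             (ℚ.≤-reflexive (trans (sym (ℚ.*-distribʳ-+ δ A B)) [A+B]δ≡ε))

_+_ : ℝ → ℝ → ℝ
x + y = mkℝ (λ n → seq x n ℚ.+ seq y n) (+-cauchy x y)

_*_ : ℝ → ℝ → ℝ
x * y = mkℝ (λ n → seq x n ℚ.* seq y n) (*-cauchy x y)

sum : ∀ {k} → Vector ℝ k → ℝ
sum = Vector.foldr _+_ 0ℝ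

⌊√_⌋ : ℕ → ℕ
⌊√ zero ⌋  = 0
⌊√ suc n ⌋ with suc ⌊√ n ⌋ ℕ.* suc ⌊√ n ⌋ ℕ.≤? suc n
... | yes _ = suc ⌊√ n ⌋
... | no  _ = ⌊√ n ⌋

⌊√n⌋²≤n : ∀ n → ⌊√ n ⌋ ℕ.* ⌊√ n ⌋ ℕ.≤ n
⌊√n⌋²≤n zero = z≤n
⌊√n⌋²≤n (suc n) with suc ⌊√ n ⌋ ℕ.* suc ⌊√ n ⌋ ℕ.≤? suc n
... | yes p = p
... | no  _ = ℕ.m≤n⇒m≤1+n (⌊√n⌋²≤n n)

n<[1+⌊√n⌋]² : ∀ n → n ℕ.< suc ⌊√ n ⌋ ℕ.* suc ⌊√ n ⌋
n<[1+⌊√n⌋]² zero = s≤s z≤n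
n<[1+⌊√n⌋]² (suc n) with suc ⌊√ n ⌋ ℕ.* suc ⌊√ n ⌋ ℕ.≤? suc n
... | yes _ = ℕ.≤-<-trans (n<[1+⌊√n⌋]² n) (ℕ.*-mono-< n<1+n n<1+n)
  where n<1+n = ℕ.n<1+n (suc ⌊√ n ⌋)
... | no ¬p = ℕ.≰⇒> ¬p

√-seq : ℕ → ℕ → ℚ
√-seq n k = (+ ⌊√ n ℕ.* (suc k ℕ.* suc k) ⌋) ℚ./ suc k

private
  √-seq-close : ∀ n j k → √-seq n j ℚ.≤ √-seq n k ℚ.+ (+ 1) ℚ./ suc k
  √-seq-close n j k = ℚ.toℚᵘ-cancel-≤ (begin
    ℚ.toℚᵘ (ℚ.fromℚᵘ (mkℚᵘ (+ a) j))
      ≃⟨ ℚ.toℚᵘ-fromℚᵘ (mkℚᵘ (+ a) j) ⟩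
    mkℚᵘ (+ a) j
      ≤⟨ *≤* (subst₂ ℤ._≤_ (ℤ.pos-* a (K ℕ.* K)) rhs
           (ℤ.+≤+ (subst₂ ℕ._≤_ (ℕ.*-assoc a K K) (shuffle b J K) (ℕ.*-monoˡ-≤ K aK≤[1+b]J)))) ⟩
    mkℚᵘ (+ b) k ℚᵘ.+ mkℚᵘ (+ 1) k
      ≃⟨ ℚᵘ.+-cong (ℚ.toℚᵘ-fromℚᵘ (mkℚᵘ (+ b) k)) (ℚ.toℚᵘ-fromℚᵘ (mkℚᵘ (+ 1) k)) ⟨
    ℚ.toℚᵘ (√-seq n k) ℚᵘ.+ ℚ.toℚᵘ ((+ 1) ℚ./ K)
      ≃⟨ ℚ.toℚᵘ-homo-+ (√-seq n k) ((+ 1) ℚ./ K) ⟨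
    ℚ.toℚᵘ (√-seq n k ℚ.+ (+ 1) ℚ./ K) ∎)
    where
    open ℚᵘ.≤-Reasoning
    J = suc j
    K = suc k
    a = ⌊√ n ℕ.* (J ℕ.* J) ⌋
    b = ⌊√ n ℕ.* (K ℕ.* K) ⌋
    shuffle : ∀ b J K → suc b ℕ.* J ℕ.* K ≡ (b ℕ.* K ℕ.+ 1 ℕ.* K) ℕ.* J
    shuffle = solve-∀
    rhs : + ((b ℕ.* K ℕ.+ 1 ℕ.* K) ℕ.* J) ≡ (+ b ℤ.* + K ℤ.+ + 1 ℤ.* + K) ℤ.* + J
    rhs = trans (ℤ.pos-* (b ℕ.* K ℕ.+ 1 ℕ.* K) J)
                (cong (ℤ._* + J) (cong₂ ℤ._+_ (ℤ.pos-* b K) (ℤ.pos-* 1 K)))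
    sq₁ : ∀ a K → (a ℕ.* K) ℕ.* (a ℕ.* K) ≡ (a ℕ.* a) ℕ.* (K ℕ.* K)
    sq₁ = solve-∀
    sq₂ : ∀ n J K → n ℕ.* (J ℕ.* J) ℕ.* (K ℕ.* K) ≡ n ℕ.* (K ℕ.* K) ℕ.* (J ℕ.* J)
    sq₂ = solve-∀
    squares : (a ℕ.* K) ℕ.* (a ℕ.* K) ℕ.≤ (suc b ℕ.* J) ℕ.* (suc b ℕ.* J)
    squares = subst₂ ℕ._≤_ (sym (sq₁ a K)) (sym (sq₁ (suc b) J))
      (ℕ.≤-trans (ℕ.*-monoˡ-≤ (K ℕ.* K) (⌊√n⌋²≤n (n ℕ.* (J ℕ.* J))))
        (subst (ℕ._≤ suc b ℕ.* suc b ℕ.* (J ℕ.* J)) (sym (sq₂ n J K))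
          (ℕ.*-monoˡ-≤ (J ℕ.* J) (ℕ.<⇒≤ (n<[1+⌊√n⌋]² (n ℕ.* (K ℕ.* K)))))))
    aK≤[1+b]J : a ℕ.* K ℕ.≤ suc b ℕ.* J
    aK≤[1+b]J = ℕ.≮⇒≥ λ gt → ℕ.<⇒≱ (ℕ.*-mono-< gt gt) squares

  archimedean : ∀ ε → 0ℚ ℚ.< ε → ∃[ N ] ∀ k → N ℕ.≤ k → (+ 1) ℚ./ suc k ℚ.≤ ε
  archimedean (mkℚ (+ 0) _ _) (*<* (ℤ.+<+ ()))
  archimedean (mkℚ ℤ.-[1+ _ ] _ _) (*<* ())
  archimedean ε@(mkℚ +[1+ m ] d _) _ = d , λ k d≤k → ℚ.toℚᵘ-cancel-≤ (begin
    ℚ.toℚᵘ ((+ 1) ℚ./ suc k) ≃⟨ ℚ.toℚᵘ-fromℚᵘ (mkℚᵘ (+ 1) k) ⟩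
    mkℚᵘ (+ 1) k             ≤⟨ *≤* (ℤ.+≤+ (ℕ.*-mono-≤ {1} {suc m} (s≤s z≤n) (s≤s d≤k))) ⟩
    ℚ.toℚᵘ ε                 ∎)
    where open ℚᵘ.≤-Reasoning

  ∣p-q∣≤ε : ∀ p q ε → p ℚ.≤ q ℚ.+ ε → q ℚ.≤ p ℚ.+ ε → ∣ p ℚ.- q ∣ ℚ.≤ ε
  ∣p-q∣≤ε p q ε p≤q+ε q≤p+ε with ℚ.∣p∣≡p∨∣p∣≡-p (p ℚ.- q)
  ... | inj₁ eq = subst₂ ℚ._≤_ (sym eq) (cancel q ε) (ℚ.+-monoˡ-≤ (ℚ.- q) p≤q+ε)
    where
    open +-*-Solver
    cancel : ∀ q ε → (q ℚ.+ ε) ℚ.- q ≡ ε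
    cancel = solve 2 (λ q ε → (q :+ ε) :- q := ε) refl
  ... | inj₂ eq = subst₂ ℚ._≤_ (trans (flip p q) (sym eq)) (cancel p ε) (ℚ.+-monoˡ-≤ (ℚ.- p) q≤p+ε)
    where
    open +-*-Solver
    cancel : ∀ q ε → (q ℚ.+ ε) ℚ.- q ≡ ε
    cancel = solve 2 (λ q ε → (q :+ ε) :- q := ε) refl
    flip : ∀ p q → q ℚ.- p ≡ ℚ.- (p ℚ.- q)
    flip = solve 2 (λ p q → q :- p := :- (p :- q)) refl

abstract
  √-cauchy : ∀ n ε → 0ℚ ℚ.< ε →
             ∃[ N ] ∀ j k → N ℕ.≤ j → N ℕ.≤ k → ∣ √-seq n j ℚ.- √-seq n k ∣ ℚ.≤ ε
  √-cauchy n ε 0<ε = let N , 1/k≤ε = archimedean ε 0<ε in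
    N , λ j k N≤j N≤k → ∣p-q∣≤ε (√-seq n j) (√-seq n k) ε
      (ℚ.≤-trans (√-seq-close n j k) (ℚ.+-monoʳ-≤ (√-seq n k) (1/k≤ε k N≤k)))
      (ℚ.≤-trans (√-seq-close n k j) (ℚ.+-monoʳ-≤ (√-seq n j) (1/k≤ε j N≤j)))

√ : ℕ → ℝ
√ n = mkℝ (√-seq n) (√-cauchy n)

infix 4 2^_≤_

-- For x ≥ 0, the real power 2^x is the supremum of the numbers 2^(a/b) with
-- a/b ≤ x a nonnegative rational, and 2^(a/b) = (2^a)^(1/b) is at most r
-- exactly when 2^a ≤ r^b.  So this says that r is an upper bound of the set
-- whose supremum is 2^x.
2^_≤_ : ℝ → ℕ → Set
2^ x ≤ r = ∀ a b .{{_ : NonZero b}} → fromℚ ((+ a) ℚ./ b) ≤ x → 2 ℕ.^ a ℕ.≤ r ℕ.^ b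

PointSet : ℕ → Set₁
PointSet d = Pred (Vector ℝ d) 0ℓ

conv : ∀ {d} → PointSet d → PointSet d
conv {d} A x =
  Σ[ k ∈ ℕ ] Σ[ p ∈ (Fin k → Vector ℝ d) ] Σ[ w ∈ Vector ℝ k ]
    (∀ j → A (p j)) ×
    (∀ j → 0ℝ ≤ w j) ×
    sum w ≈ 1ℝ ×
    (∀ i → x i ≈ sum λ j → w j * p j i)

Matrix : ℕ → ℕ → Set
Matrix m n = Fin m → Fin n → ℝ

infixr 7 _∙_

_∙_ : ∀ {m n} → Matrix m n → Vector ℝ n → Vector ℝ m
(M ∙ x) i = sum λ j → M i j * x j

record System (d k : ℕ) : Set where
  field
    #eq #ineq : ℕ
    E⁼ : Matrix #eq d
    F⁼ : Matrix #eq k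
    g⁼ : Vector ℝ #eq
    E≤ : Matrix #ineq d
    F≤ : Matrix #ineq k
    g≤ : Vector ℝ #ineq

  Satisfies : Vector ℝ d → Vector ℝ k → Set
  Satisfies x y =
    (∀ i → (E⁼ ∙ x) i + (F⁼ ∙ y) i ≈ g⁼ i) ×
    (∀ i → (E≤ ∙ x) i + (F≤ ∙ y) i ≤ g≤ i)

_IsExtendedFormulationOf_ : ∀ {d k} → System d k → PointSet d → Set
Q IsExtendedFormulationOf P = ∀ x → P x ⇔ (∃[ y ] System.Satisfies Q x y)

size : ∀ {d k} → System d k → ℕ
size = System.#ineq

IsExtensionComplexity : ∀ {d} → PointSet d → ℕ → Set
IsExtensionComplexity {d} P r =
  (∃[ k ] Σ[ Q ∈ System d k ] Q IsExtendedFormulationOf P × size Q ≡ r) ×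
  (∀ {k} (Q : System d k) → Q IsExtendedFormulationOf P → r ℕ.≤ size Q)

record Graph (n : ℕ) : Set₁ where
  field
    _~_      : Rel (Fin n) 0ℓ
    _~?_     : Decidable _~_
    ~-sym    : Symmetric _~_
    ~-irrefl : Irreflexive _≡_ _~_

module _ {n} (G : Graph n) where
  open Graph G

  Stable : Subset n → Set
  Stable S = ∀ {u v} → u ∈ S → v ∈ S → ¬ (u ~ v)

χ : ∀ {n} → Subset n → Vector ℝ n
χ S i = if lookup S i then 1ℝ else 0ℝ

STAB : ∀ {n} → Graph n → PointSet n
STAB G = conv λ v → ∃[ S ] Stable G S × (∀ i → v i ≈ χ S i)

{-# OPTIONS --safe #-}
module Submission where

open import Algebra.Bundles using (CommutativeSemiring)
import Algebra.Properties.Semiring.Sum as SemiringSum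
import Algebra.Solver.Ring.NaturalCoefficients.Default as SemiringSolver
open import Algebra.Structures using (IsCommutativeSemiring)
open import Algebra.Structures.Biased using (IsCommutativeSemiringˡ)
open import Data.Bool.Base using (Bool; true; false; T; not; _∧_; _∨_; if_then_else_)
import Data.Bool.Properties as Bool
open import Data.Empty using (⊥)
open import Data.Fin.Base using (Fin; zero; suc; toℕ; fromℕ<; inject≤; combine; remQuot)
import Data.Fin.Properties as Fin
open import Data.Fin.Subset using (Subset; _∩_; _∈_) renaming (∣_∣ to card)
open import Data.Integer.Base as ℤ using (+_)
import Data.Integer.Properties as ℤ
open import Data.List.Base as List using (List; []; _∷_; _++_; length)
open import Data.List.Relation.Unary.All as All using (All; []; _∷_)
import Data.List.Relation.Unary.All.Properties as All
open import Data.List.Relation.Unary.AllPairs using ([]; _∷_)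
open import Data.List.Relation.Unary.Unique.Propositional using (Unique)
import Data.List.Relation.Unary.Unique.Propositional.Properties as Unique
open import Data.Maybe.Base using (Maybe; just; nothing; maybe′)
open import Data.Maybe.Properties using (just-injective)
open import Data.Nat.Base as ℕ using (ℕ; zero; suc; NonZero; z≤n; s≤s)
import Data.Nat.Properties as ℕ
open import Data.Nat.Tactic.RingSolver using (solve-∀)
open import Data.Product.Base using (Σ-syntax; ∃-syntax; _×_; _,_; proj₁; proj₂; swap)
open import Data.Rational.Base as ℚ using (ℚ; 0ℚ; 1ℚ; ½; ∣_∣; nonNegative; positive)
import Data.Rational.Properties as ℚ
open import Data.Rational.Solver using (module +-*-Solver)
open import Data.Rational.Unnormalised.Base as ℚᵘ using (mkℚᵘ; *≤*)
import Data.Rational.Unnormalised.Properties as ℚᵘ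
open import Data.Sum.Base using (inj₁; inj₂)
open import Data.Unit.Base using (⊤; tt)
open import Data.Vec.Base using ([]; _∷_; lookup; tabulate)
open import Data.Vec.Functional as Vector using (Vector)
import Data.Vec.Properties as Vec
open import Effect.Monad using (RawMonad)
open import Function.Base using (_∘_)
open import Function.Bundles using (Equivalence)
open import Level using (0ℓ)
open import Relation.Binary.Bundles using (Poset)
open import Relation.Binary.Core using (Rel)
open import Relation.Binary.Definitions using (tri<; tri≈; tri>)
open import Relation.Binary.PropositionalEquality
  using (_≡_; _≢_; _≗_; refl; sym; trans; cong; cong₂; subst; subst₂; ≢-sym)
import Relation.Binary.Reasoning.PartialOrder as PosetReasoning
open import Relation.Binary.Structures using (IsPartialOrder)
open import Relation.Nullary using (¬_; Dec; yes; no; contradiction)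
open import Relation.Nullary.Decidable
  using (⌊_⌋; toWitness; fromWitness; decidable-stable; ¬¬-excluded-middle; _×-dec_)
open import Relation.Nullary.Negation using (¬¬-Monad)

-- Take m = ⌊√ n ⌋ and let G n be the complete graph on m vertices with every
-- edge subdivided twice (m² vertices x_ij, with x_ii the original ones), plus
-- isolated vertices.  For a ⊆ [m], ∑_{i,j ∈ a} x_ij ≤ C(|a|,2) + 1 is valid for
-- STAB (G n), and every b ⊆ [m] has a stable set S_b that attains equality when
-- |a ∩ b| = 1 but not when a ∩ b = ∅.  Lift each χ^{S_b} to a point of the
-- extended formulation, and let a ∩ b = ∅ with a ≠ ∅.  Some inequality is slack at
-- the lift of S_b and tight at the lifts of all S_c with |a ∩ c| = 1: otherwise
-- a point slightly beyond a weighted mean of such S_c, seen from S_b, would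
-- still satisfy the formulation and violate the inequality of a.  So each
-- inequality of the formulation yields a rectangle without pairs |a ∩ b| = 1,
-- and these rectangles cover the disjoint pairs with a ≠ ∅.  By the argument of
-- Kaibel and Weltge such a rectangle contains at most 2^m of the 3^m disjoint
-- pairs, hence 3^m ≤ (1 + r) 2^m.  This bound is decidable, so it may be proved
-- up to double negation, where the order of the reals is decidable.

⟦_⟧ : Bool → ℕ
⟦ b ⟧ = if b then 1 else 0

count : ∀ {A : Set} → (A → Bool) → List A → ℕ
count s []      = 0
count s (x ∷ l) = ⟦ s x ⟧ ℕ.+ count s l

-- Linear combinations over an ordered semiring

record OrderedSemiring : Set₁ where
  field
    commutativeSemiring : CommutativeSemiring 0ℓ 0ℓ
  open CommutativeSemiring commutativeSemiring public
  infix 4 _≤_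
  field
    _≤_            : Rel Carrier 0ℓ
    isPartialOrder : IsPartialOrder _≈_ _≤_
    +-mono-≤       : ∀ {x y u v} → x ≤ y → u ≤ v → x + u ≤ y + v

module Combinations (R : OrderedSemiring) where
  open OrderedSemiring R hiding (zero) renaming (refl to ≈-refl; sym to ≈-sym; trans to ≈-trans)
  open SemiringSum semiring
  open SemiringSolver commutativeSemiring using (solve; _:+_; _:*_; _:=_)

  poset : Poset 0ℓ 0ℓ 0ℓ
  poset = record { isPartialOrder = isPartialOrder }

  module ≤ = Poset poset
  module ≤-Reasoning = PosetReasoning poset
  open ≤-Reasoning

  Matrix : ℕ → ℕ → Set
  Matrix m n = Fin m → Fin n → Carrier

  infixr 7 _∙_

  _∙_ : ∀ {m n} → Matrix m n → Vector Carrier n → Vector Carrier m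
  (M ∙ x) i = sum λ j → M i j * x j

  comb : ∀ {J d} → Vector Carrier J → (Fin J → Vector Carrier d) → Vector Carrier d
  comb w p i = sum λ j → w j * p j i

  ∙-comb : ∀ {J r d} (M : Matrix r d) (w : Vector Carrier J) (p : Fin J → Vector Carrier d) i →
           (M ∙ comb w p) i ≈ sum λ j → w j * (M ∙ p j) i
  ∙-comb M w p i = begin-equality
    (sum λ k → M i k * sum λ j → w j * p j k)
      ≈⟨ sum-cong-≋ (λ k → *-distribˡ-sum (M i k) (λ j → w j * p j k)) ⟩
    (sum λ k → sum λ j → M i k * (w j * p j k))
      ≈⟨ ∑-comm (λ k j → M i k * (w j * p j k)) ⟩
    (sum λ j → sum λ k → M i k * (w j * p j k))
      ≈⟨ sum-cong-≋ (λ j → sum-cong-≋ λ k →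
           solve 3 (λ a b c → a :* (b :* c) := b :* (a :* c)) ≈-refl (M i k) (w j) (p j k)) ⟩
    (sum λ j → sum λ k → w j * (M i k * p j k))
      ≈⟨ sum-cong-≋ (λ j → *-distribˡ-sum (w j) (λ k → M i k * p j k)) ⟨
    (sum λ j → w j * (M ∙ p j) i) ∎

  ∙+∙-comb : ∀ {J r d k} (E : Matrix r d) (F : Matrix r k) (w : Vector Carrier J)
             (p : Fin J → Vector Carrier d) (q : Fin J → Vector Carrier k) i →
             (E ∙ comb w p) i + (F ∙ comb w q) i ≈ sum λ j → w j * ((E ∙ p j) i + (F ∙ q j) i)
  ∙+∙-comb E F w p q i = begin-equality
    (E ∙ comb w p) i + (F ∙ comb w q) i
      ≈⟨ +-cong (∙-comb E w p i) (∙-comb F w q i) ⟩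
    (sum λ j → w j * (E ∙ p j) i) + (sum λ j → w j * (F ∙ q j) i)
      ≈⟨ ∑-distrib-+ (λ j → w j * (E ∙ p j) i) (λ j → w j * (F ∙ q j) i) ⟨
    (sum λ j → w j * (E ∙ p j) i + w j * (F ∙ q j) i)
      ≈⟨ sum-cong-≋ (λ j → distribˡ (w j) _ _) ⟨
    (sum λ j → w j * ((E ∙ p j) i + (F ∙ q j) i)) ∎

  listSum : ∀ {n} → List (Fin n) → Vector Carrier n → Carrier
  listSum l x = List.foldr (λ v s → x v + s) 0# l

  listSum-cong : ∀ {n} (l : List (Fin n)) {x y : Vector Carrier n} →
                 (∀ v → x v ≈ y v) → listSum l x ≈ listSum l y
  listSum-cong []      h = ≈-refl
  listSum-cong (v ∷ l) h = +-cong (h v) (listSum-cong l h)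

  listSum-comb : ∀ {J n} (l : List (Fin n)) (w : Vector Carrier J) p →
                 listSum l (comb w p) ≈ sum λ j → w j * listSum l (p j)
  listSum-comb {J} [] w p = ≈-sym (begin-equality
    (sum λ j → w j * 0#)  ≈⟨ sum-cong-≋ (λ j → zeroʳ (w j)) ⟩
    (sum {J} λ _ → 0#)    ≈⟨ sum-replicate-zero J ⟩
    0#                    ∎)
  listSum-comb (v ∷ l) w p = begin-equality
    comb w p v + listSum l (comb w p)
      ≈⟨ +-congˡ (listSum-comb l w p) ⟩
    comb w p v + (sum λ j → w j * listSum l (p j))
      ≈⟨ ∑-distrib-+ (λ j → w j * p j v) (λ j → w j * listSum l (p j)) ⟨
    (sum λ j → w j * p j v + w j * listSum l (p j))
      ≈⟨ sum-cong-≋ (λ j → distribˡ (w j) (p j v) (listSum l (p j))) ⟨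
    (sum λ j → w j * (p j v + listSum l (p j))) ∎

  +-monoˡ-≤ : ∀ z {x y} → x ≤ y → x + z ≤ y + z
  +-monoˡ-≤ z x≤y = +-mono-≤ x≤y ≤.refl

  +-monoʳ-≤ : ∀ z {x y} → x ≤ y → z + x ≤ z + y
  +-monoʳ-≤ z x≤y = +-mono-≤ ≤.refl x≤y

  sum-mono : ∀ {J} {x y : Vector Carrier J} → (∀ j → x j ≤ y j) → sum x ≤ sum y
  sum-mono {zero}  h = ≤.refl
  sum-mono {suc J} h = +-mono-≤ (h zero) (sum-mono (h ∘ suc))

  sum-mono-+ : ∀ {J} {x y : Vector Carrier J} {u v} → (∀ j → x j ≤ y j) →
               ∀ i → x i + u ≤ y i + v → sum x + u ≤ sum y + v
  sum-mono-+ {suc J} {x} {y} {u} {v} h zero xᵢ+u≤yᵢ+v = begin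
    x zero + sum (x ∘ suc) + u    ≈⟨ swap-last (x zero) (sum (x ∘ suc)) u ⟩
    (x zero + u) + sum (x ∘ suc)  ≤⟨ +-mono-≤ xᵢ+u≤yᵢ+v (sum-mono (h ∘ suc)) ⟩
    (y zero + v) + sum (y ∘ suc)  ≈⟨ swap-last (y zero) v (sum (y ∘ suc)) ⟩
    y zero + sum (y ∘ suc) + v    ∎
    where
    swap-last : ∀ a b c → a + b + c ≈ a + c + b
    swap-last = solve 3 (λ a b c → a :+ b :+ c := a :+ c :+ b) ≈-refl
  sum-mono-+ {suc J} {x} {y} {u} {v} h (suc i) xᵢ+u≤yᵢ+v = begin
    x zero + sum (x ∘ suc) + u    ≈⟨ +-assoc (x zero) (sum (x ∘ suc)) u ⟩
    x zero + (sum (x ∘ suc) + u)  ≤⟨ +-mono-≤ (h zero) (sum-mono-+ (h ∘ suc) i xᵢ+u≤yᵢ+v) ⟩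
    y zero + (sum (y ∘ suc) + v)  ≈⟨ +-assoc (y zero) (sum (y ∘ suc)) v ⟨
    y zero + sum (y ∘ suc) + v    ∎

  nat : ℕ → Carrier
  nat zero    = 0#
  nat (suc k) = 1# + nat k

  listSum-indicator : ∀ {n} (s : Fin n → Bool) l →
                      listSum l (λ v → if s v then 1# else 0#) ≈ nat (count s l)
  listSum-indicator s []      = ≈-refl
  listSum-indicator s (v ∷ l) = ≈-trans (+-congˡ (listSum-indicator s l)) (step (s v) (count s l))
    where
    step : ∀ b k → (if b then 1# else 0#) + nat k ≈ nat (⟦ b ⟧ ℕ.+ k)
    step true  k = ≈-refl
    step false k = +-identityˡ (nat k)

  *-nat-mono-≤ : ∀ {w} → 0# ≤ w → ∀ {j k} → j ℕ.≤ k → w * nat j ≤ w * nat k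
  *-nat-mono-≤ {w} 0≤w {zero} {zero}  z≤n = ≤.refl
  *-nat-mono-≤ {w} 0≤w {zero} {suc k} z≤n = begin
    w * 0#              ≈⟨ +-identityˡ (w * 0#) ⟨
    0# + w * 0#         ≤⟨ +-mono-≤ 0≤w (*-nat-mono-≤ 0≤w {zero} {k} z≤n) ⟩
    w + w * nat k       ≈⟨ +-congʳ (*-identityʳ w) ⟨
    w * 1# + w * nat k  ≈⟨ distribˡ w 1# (nat k) ⟨
    w * (1# + nat k)    ∎
  *-nat-mono-≤ {w} 0≤w {suc j} {suc k} (s≤s j≤k) = begin
    w * (1# + nat j)    ≈⟨ distribˡ w 1# (nat j) ⟩
    w * 1# + w * nat j  ≤⟨ +-monoʳ-≤ (w * 1#) (*-nat-mono-≤ 0≤w j≤k) ⟩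
    w * 1# + w * nat k  ≈⟨ distribˡ w 1# (nat k) ⟨
    w * (1# + nat k)    ∎

  nat-mono-≤ : 0# ≤ 1# → ∀ {j k} → j ℕ.≤ k → nat j ≤ nat k
  nat-mono-≤ 0≤1 {j} {k} j≤k = begin
    nat j        ≈⟨ *-identityˡ (nat j) ⟨
    1# * nat j   ≤⟨ *-nat-mono-≤ 0≤1 j≤k ⟩
    1# * nat k   ≈⟨ *-identityˡ (nat k) ⟩
    nat k        ∎

  convex-bound : ∀ {J n} (l : List (Fin n)) β (w : Vector Carrier J) (p : Fin J → Vector Carrier n) →
                 (∀ j → 0# ≤ w j) → sum w ≈ 1# →
                 (∀ j → ∃[ k ] k ℕ.≤ β × listSum l (p j) ≈ nat k) →
                 ∀ x → (∀ v → x v ≈ comb w p v) → listSum l x ≤ nat β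
  convex-bound l β w p 0≤w ∑w≈1 vertex x x≈comb = begin
    listSum l x                         ≈⟨ listSum-cong l x≈comb ⟩
    listSum l (comb w p)                ≈⟨ listSum-comb l w p ⟩
    (sum λ j → w j * listSum l (p j))   ≤⟨ sum-mono (λ j → let k , k≤β , pⱼ≈k = vertex j in
                                             ≤.trans (≤.reflexive (*-congˡ pⱼ≈k)) (*-nat-mono-≤ (0≤w j) k≤β)) ⟩
    (sum λ j → w j * nat β)             ≈⟨ *-distribʳ-sum (nat β) w ⟨
    sum w * nat β                       ≈⟨ *-congʳ ∑w≈1 ⟩
    1# * nat β                          ≈⟨ *-identityˡ (nat β) ⟩
    nat β                               ∎

  -- With v = −u the weights below sum to u (K₁ + … + K_J − 1) = 1; they
  -- move from the 0-th point through the K-weighted mean of the others and beyond.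
  module Extrapolation {J} (K : Vector Carrier J) {u v}
    (v+u≈0 : v + u ≈ 0#) (u*∑K≈1+u : u * sum K ≈ 1# + u)
    (u-mono : ∀ {x y} → x ≤ y → u * x ≤ u * y) where

    weights : Vector Carrier (suc J)
    weights zero    = v
    weights (suc j) = u * K j

    private
      N = sum K

      weighted-sum : ∀ (L : Vector Carrier (suc J)) → (sum λ j → weights j * L j) ≈ v * L zero + u * (sum λ j → K j * L (suc j))
      weighted-sum L = +-congˡ (begin-equality
        (sum λ j → u * K j * L (suc j))      ≈⟨ sum-cong-≋ (λ j → *-assoc u (K j) (L (suc j))) ⟩
        (sum λ j → u * (K j * L (suc j)))    ≈⟨ *-distribˡ-sum u (λ j → K j * L (suc j)) ⟨
        u * (sum λ j → K j * L (suc j))      ∎)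

      left : ∀ a A g → v * a + u * A ≈ v * (a + g) + u * (A + g)
      left a A g = begin-equality
        v * a + u * A                 ≈⟨ +-identityʳ (v * a + u * A) ⟨
        v * a + u * A + 0#            ≈⟨ +-congˡ (zeroˡ g) ⟨
        v * a + u * A + 0# * g        ≈⟨ +-congˡ (*-congʳ v+u≈0) ⟨
        v * a + u * A + (v + u) * g   ≈⟨ solve 5 (λ u v a A g → v :* a :+ u :* A :+ (v :+ u) :* g := v :* (a :+ g) :+ u :* (A :+ g)) ≈-refl u v a A g ⟩
        v * (a + g) + u * (A + g)     ∎

      right : ∀ a g → v * (a + g) + u * (N * g + a) ≈ g
      right a g = begin-equality
        v * (a + g) + u * (N * g + a)        ≈⟨ solve 5 (λ u v a N g → v :* (a :+ g) :+ u :* (N :* g :+ a) := (v :+ u) :* a :+ (u :* N :* g :+ v :* g)) ≈-refl u v a N g ⟩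
        (v + u) * a + (u * N * g + v * g)    ≈⟨ +-cong (*-congʳ v+u≈0) (+-congʳ (*-congʳ u*∑K≈1+u)) ⟩
        0# * a + ((1# + u) * g + v * g)      ≈⟨ +-cong (zeroˡ a) (≈-sym (distribʳ g (1# + u) v)) ⟩
        0# + (1# + u + v) * g                ≈⟨ +-identityˡ ((1# + u + v) * g) ⟩
        (1# + u + v) * g                     ≈⟨ *-congʳ (≈-trans (+-assoc 1# u v) (+-congˡ (≈-trans (+-comm u v) v+u≈0))) ⟩
        (1# + 0#) * g                        ≈⟨ *-congʳ (+-identityʳ 1#) ⟩
        1# * g                               ≈⟨ *-identityˡ g ⟩
        g                                    ∎

    extrapolate-≤ : ∀ (L : Vector Carrier (suc J)) g → (sum λ j → K j * L (suc j)) + g ≤ N * g + L zero →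
                    (sum λ j → weights j * L j) ≤ g
    extrapolate-≤ L g h = begin
      (sum λ j → weights j * L j)                ≈⟨ weighted-sum L ⟩
      v * L zero + u * A                         ≈⟨ left (L zero) A g ⟩
      v * (L zero + g) + u * (A + g)             ≤⟨ +-monoʳ-≤ (v * (L zero + g)) (u-mono h) ⟩
      v * (L zero + g) + u * (N * g + L zero)    ≈⟨ right (L zero) g ⟩
      g                                          ∎
      where A = sum λ j → K j * L (suc j)

    extrapolate-≥ : ∀ (L : Vector Carrier (suc J)) g → N * g + L zero ≤ (sum λ j → K j * L (suc j)) + g →
                    g ≤ (sum λ j → weights j * L j)
    extrapolate-≥ L g h = begin
      g                                          ≈⟨ right (L zero) g ⟨
      v * (L zero + g) + u * (N * g + L zero)    ≤⟨ +-monoʳ-≤ (v * (L zero + g)) (u-mono h) ⟩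
      v * (L zero + g) + u * (A + g)             ≈⟨ left (L zero) A g ⟨
      v * L zero + u * A                         ≈⟨ weighted-sum L ⟨
      (sum λ j → weights j * L j)                ∎
      where A = sum λ j → K j * L (suc j)

    extrapolate-≈ : ∀ (L : Vector Carrier (suc J)) g → (∀ j → L j ≈ g) → (sum λ j → weights j * L j) ≈ g
    extrapolate-≈ L g L≈g = ≤.antisym (extrapolate-≤ L g (≤.reflexive equal))
                                      (extrapolate-≥ L g (≤.reflexive (≈-sym equal)))
      where
      equal : (sum λ j → K j * L (suc j)) + g ≈ N * g + L zero
      equal = +-cong (≈-trans (sum-cong-≋ λ j → *-congˡ (L≈g (suc j))) (≈-sym (*-distribʳ-sum g K)))
                     (≈-sym (L≈g zero))

    extrapolate-slack : ∀ (L : Vector Carrier (suc J)) g → (∀ j → K j * L (suc j) ≤ K j * g) →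
                        ∀ i → K i * L (suc i) + g ≤ K i * g + L zero →
                        (sum λ j → weights j * L j) ≤ g
    extrapolate-slack L g h i hᵢ = extrapolate-≤ L g (begin
      (sum λ j → K j * L (suc j)) + g     ≤⟨ sum-mono-+ h i hᵢ ⟩
      (sum λ j → K j * g) + L zero        ≈⟨ +-congʳ (*-distribʳ-sum g K) ⟨
      N * g + L zero                      ∎)

    extrapolate-beyond : ∀ (L : Vector Carrier (suc J)) β → (∀ j → L (suc j) ≈ β) → L zero + 1# ≤ β →
                         β + u ≤ (sum λ j → weights j * L j)
    extrapolate-beyond L β L≈β L₀+1≤β = extrapolate-≥ L (β + u) (begin
      N * (β + u) + L zero                      ≈⟨ solve 4 (λ N β u a → N :* (β :+ u) :+ a := N :* β :+ (u :* N :+ a)) ≈-refl N β u (L zero) ⟩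
      N * β + (u * N + L zero)                  ≈⟨ +-congˡ (+-congʳ u*∑K≈1+u) ⟩
      N * β + (1# + u + L zero)                 ≈⟨ +-congˡ (≈-trans (+-comm (1# + u) (L zero)) (≈-sym (+-assoc (L zero) 1# u))) ⟩
      N * β + (L zero + 1# + u)                 ≤⟨ +-monoʳ-≤ (N * β) (+-monoˡ-≤ u L₀+1≤β) ⟩
      N * β + (β + u)                           ≈⟨ +-congʳ (≈-trans (*-distribʳ-sum β K) (sum-cong-≋ λ j → *-congˡ (≈-sym (L≈β j)))) ⟩
      (sum λ j → K j * L (suc j)) + (β + u)     ∎)

open import Defs

-- Order and arithmetic of the reals

Eventually : (ℕ → Set) → Set
Eventually P = ∃[ N ] ∀ n → N ℕ.≤ n → P n

eventually₂ : ∀ {P Q R : ℕ → Set} → (∀ n → P n → Q n → R n) →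
              Eventually P → Eventually Q → Eventually R
eventually₂ f (M , p) (N , q) = M ℕ.⊔ N , λ n M⊔N≤n →
  f n (p n (ℕ.m⊔n≤o⇒m≤o M N M⊔N≤n)) (q n (ℕ.m⊔n≤o⇒n≤o M N M⊔N≤n))

eventually-map : ∀ {P Q : ℕ → Set} → (∀ n → P n → Q n) → Eventually P → Eventually Q
eventually-map f (N , p) = N , λ n N≤n → f n (p n N≤n)

0<½ε : ∀ {ε} → 0ℚ ℚ.< ε → 0ℚ ℚ.< ½ ℚ.* ε
0<½ε {ε} 0<ε = subst (ℚ._< ½ ℚ.* ε) (ℚ.*-zeroʳ ½) (ℚ.*-monoʳ-<-pos ½ 0<ε)

½ε+½ε≡ε : ∀ ε → ½ ℚ.* ε ℚ.+ ½ ℚ.* ε ≡ ε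
½ε+½ε≡ε ε = trans (sym (ℚ.*-distribʳ-+ ε ½ ½)) (ℚ.*-identityˡ ε)

0<1ℚ : 0ℚ ℚ.< 1ℚ
0<1ℚ = ℚ.positive⁻¹ 1ℚ

divide : ∀ {B ε} → 0ℚ ℚ.< B → 0ℚ ℚ.< ε → ∃[ δ ] 0ℚ ℚ.< δ × B ℚ.* δ ≡ ε
divide {B} {ε} 0<B 0<ε = 1/B ℚ.* ε
  , subst (ℚ._< 1/B ℚ.* ε) (ℚ.*-zeroʳ 1/B) (ℚ.*-monoʳ-<-pos 1/B {{1/B-pos}} 0<ε)
  , trans (sym (ℚ.*-assoc B 1/B ε))
          (trans (cong (ℚ._* ε) (ℚ.*-inverseʳ B {{B≢0}})) (ℚ.*-identityˡ ε))
  where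
  B≢0 : ℚ.NonZero B
  B≢0 = ℚ.pos⇒nonZero B {{positive 0<B}}
  1/B : ℚ
  1/B = ℚ.1/_ B {{B≢0}}
  1/B-pos : ℚ.Positive 1/B
  1/B-pos = ℚ.1/pos⇒pos B {{positive 0<B}}

bounded : ∀ x → ∃[ B ] 0ℚ ℚ.< B × Eventually λ n → ∣ seq x n ∣ ℚ.≤ B
bounded x with cauchy x 1ℚ 0<1ℚ
... | N , p = 1ℚ ℚ.+ ∣ seq x N ∣
            , ℚ.+-mono-<-≤ {0ℚ} {1ℚ} {0ℚ} 0<1ℚ (ℚ.0≤∣p∣ (seq x N))
            , N , λ n N≤n → begin
  ∣ seq x n ∣
    ≡⟨ cong ∣_∣ (split (seq x n) (seq x N)) ⟩
  ∣ (seq x n ℚ.- seq x N) ℚ.+ seq x N ∣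
    ≤⟨ ℚ.∣p+q∣≤∣p∣+∣q∣ (seq x n ℚ.- seq x N) (seq x N) ⟩
  ∣ seq x n ℚ.- seq x N ∣ ℚ.+ ∣ seq x N ∣
    ≤⟨ ℚ.+-monoˡ-≤ ∣ seq x N ∣ (p n N N≤n ℕ.≤-refl) ⟩
  1ℚ ℚ.+ ∣ seq x N ∣ ∎
  where
  open ℚ.≤-Reasoning
  open +-*-Solver
  split : ∀ a b → a ≡ (a ℚ.- b) ℚ.+ b
  split = solve 2 (λ a b → a := (a :- b) :+ b) refl

p≤∣p∣ : ∀ p → p ℚ.≤ ∣ p ∣
p≤∣p∣ p with ℚ.≤-total 0ℚ p
... | inj₁ 0≤p = ℚ.≤-reflexive (sym (ℚ.0≤p⇒∣p∣≡p 0≤p))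
... | inj₂ p≤0 = ℚ.≤-trans p≤0 (ℚ.0≤∣p∣ p)

private
  p≤q+∣p-q∣ : ∀ p q → p ℚ.≤ q ℚ.+ ∣ p ℚ.- q ∣
  p≤q+∣p-q∣ p q = subst (ℚ._≤ q ℚ.+ ∣ p ℚ.- q ∣) (cancel p q)
    (ℚ.+-monoʳ-≤ q (p≤∣p∣ (p ℚ.- q)))
    where
    open +-*-Solver
    cancel : ∀ p q → q ℚ.+ (p ℚ.- q) ≡ p
    cancel = solve 2 (λ p q → q :+ (p :- q) := p) refl

  ∣p-q∣≤ : ∀ {p q δ} → p ℚ.≤ q ℚ.+ δ → q ℚ.≤ p ℚ.+ δ → ∣ p ℚ.- q ∣ ℚ.≤ δ
  ∣p-q∣≤ {p} {q} {δ} p≤q+δ q≤p+δ with ℚ.∣p∣≡p∨∣p∣≡-p (p ℚ.- q)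
  ... | inj₁ eq = subst₂ ℚ._≤_ (sym eq) (cancel q δ) (ℚ.+-monoˡ-≤ (ℚ.- q) p≤q+δ)
    where
    open +-*-Solver
    cancel : ∀ q δ → (q ℚ.+ δ) ℚ.- q ≡ δ
    cancel = solve 2 (λ q δ → (q :+ δ) :- q := δ) refl
  ... | inj₂ eq = subst₂ ℚ._≤_ (trans (flip p q) (sym eq)) (cancel p δ) (ℚ.+-monoˡ-≤ (ℚ.- p) q≤p+δ)
    where
    open +-*-Solver
    cancel : ∀ q δ → (q ℚ.+ δ) ℚ.- q ≡ δ
    cancel = solve 2 (λ q δ → (q :+ δ) :- q := δ) refl
    flip : ∀ p q → q ℚ.- p ≡ ℚ.- (p ℚ.- q)
    flip = solve 2 (λ p q → q :- p := :- (p :- q)) refl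

≤-pointwise : ∀ {x y} → (∀ n → seq x n ℚ.≤ seq y n) → x ≤ y
≤-pointwise {x} {y} p = mk≤ λ ε 0<ε → 0 , λ n _ →
  subst (ℚ._≤ seq y n ℚ.+ ε) (ℚ.+-identityʳ (seq x n)) (ℚ.+-mono-≤ (p n) (ℚ.<⇒≤ 0<ε))

≈-pointwise : ∀ {x y} → (∀ n → seq x n ≡ seq y n) → x ≈ y
≈-pointwise p = ≤-pointwise (λ n → ℚ.≤-reflexive (p n))
              , ≤-pointwise (λ n → ℚ.≤-reflexive (sym (p n)))

≤-trans : ∀ {x y z} → x ≤ y → y ≤ z → x ≤ z
≤-trans {x} {y} {z} (mk≤ p) (mk≤ q) = mk≤ λ ε 0<ε →
  eventually₂ (λ n x≤y y≤z → begin
    seq x n                             ≤⟨ x≤y ⟩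
    seq y n ℚ.+ ½ ℚ.* ε                 ≤⟨ ℚ.+-monoˡ-≤ (½ ℚ.* ε) y≤z ⟩
    seq z n ℚ.+ ½ ℚ.* ε ℚ.+ ½ ℚ.* ε     ≡⟨ ℚ.+-assoc (seq z n) _ _ ⟩
    seq z n ℚ.+ (½ ℚ.* ε ℚ.+ ½ ℚ.* ε)   ≡⟨ cong (seq z n ℚ.+_) (½ε+½ε≡ε ε) ⟩
    seq z n ℚ.+ ε                       ∎)
    (p (½ ℚ.* ε) (0<½ε 0<ε)) (q (½ ℚ.* ε) (0<½ε 0<ε))
  where open ℚ.≤-Reasoning

ℝ-poset : Poset 0ℓ 0ℓ 0ℓ
ℝ-poset = record
  { Carrier = ℝ
  ; _≈_ = _≈_
  ; _≤_ = _≤_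
  ; isPartialOrder = record
    { isPreorder = record
      { isEquivalence = record
        { refl  = ≈-pointwise λ _ → refl
        ; sym   = swap
        ; trans = λ (p , q) (r , s) → ≤-trans p r , ≤-trans s q
        }
      ; reflexive = proj₁
      ; trans = ≤-trans
      }
    ; antisym = _,_
    }
  }

module ℝ-≤ = Poset ℝ-poset

+-mono-≤ : ∀ {x y u v} → x ≤ y → u ≤ v → x + u ≤ y + v
+-mono-≤ {x} {y} {u} {v} (mk≤ p) (mk≤ q) = mk≤ λ ε 0<ε →
  eventually₂ (λ n x≤y u≤v → begin
    seq x n ℚ.+ seq u n
      ≤⟨ ℚ.+-mono-≤ x≤y u≤v ⟩
    (seq y n ℚ.+ ½ ℚ.* ε) ℚ.+ (seq v n ℚ.+ ½ ℚ.* ε)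
      ≡⟨ rearrange (seq y n) (seq v n) (½ ℚ.* ε) ⟩
    seq y n ℚ.+ seq v n ℚ.+ (½ ℚ.* ε ℚ.+ ½ ℚ.* ε)
      ≡⟨ cong (seq y n ℚ.+ seq v n ℚ.+_) (½ε+½ε≡ε ε) ⟩
    seq y n ℚ.+ seq v n ℚ.+ ε ∎)
    (p (½ ℚ.* ε) (0<½ε 0<ε)) (q (½ ℚ.* ε) (0<½ε 0<ε))
  where
  open ℚ.≤-Reasoning
  open +-*-Solver
  rearrange : ∀ a b c → (a ℚ.+ c) ℚ.+ (b ℚ.+ c) ≡ a ℚ.+ b ℚ.+ (c ℚ.+ c)
  rearrange = solve 3 (λ a b c → (a :+ c) :+ (b :+ c) := a :+ b :+ (c :+ c)) refl

*-congˡ-≤ : ∀ z {x y} → x ≈ y → z * x ≤ z * y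
*-congˡ-≤ z {x} {y} (mk≤ p , mk≤ q) = mk≤ λ ε 0<ε →
  let
    B , 0<B , b = bounded z
    δ , 0<δ , Bδ≡ε = divide 0<B 0<ε
  in eventually₂ (λ n ∣z∣≤B (x≤y , y≤x) → let open ℚ.≤-Reasoning in begin
    seq z n ℚ.* seq x n
      ≤⟨ p≤q+∣p-q∣ (seq z n ℚ.* seq x n) (seq z n ℚ.* seq y n) ⟩
    seq z n ℚ.* seq y n ℚ.+ ∣ seq z n ℚ.* seq x n ℚ.- seq z n ℚ.* seq y n ∣
      ≡⟨ cong (λ t → seq z n ℚ.* seq y n ℚ.+ ∣ t ∣) (factor (seq z n) (seq x n) (seq y n)) ⟩
    seq z n ℚ.* seq y n ℚ.+ ∣ seq z n ℚ.* (seq x n ℚ.- seq y n) ∣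
      ≡⟨ cong (seq z n ℚ.* seq y n ℚ.+_) (ℚ.∣p*q∣≡∣p∣*∣q∣ (seq z n) _) ⟩
    seq z n ℚ.* seq y n ℚ.+ ∣ seq z n ∣ ℚ.* ∣ seq x n ℚ.- seq y n ∣
      ≤⟨ ℚ.+-monoʳ-≤ (seq z n ℚ.* seq y n)
           (ℚ.≤-trans
             (ℚ.*-monoʳ-≤-nonNeg ∣ seq x n ℚ.- seq y n ∣ {{nonNegative (ℚ.0≤∣p∣ (seq x n ℚ.- seq y n))}} ∣z∣≤B)
             (ℚ.*-monoˡ-≤-nonNeg B {{nonNegative (ℚ.<⇒≤ 0<B)}} (∣p-q∣≤ {seq x n} {seq y n} x≤y y≤x))) ⟩
    seq z n ℚ.* seq y n ℚ.+ B ℚ.* δ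
      ≡⟨ cong (seq z n ℚ.* seq y n ℚ.+_) Bδ≡ε ⟩
    seq z n ℚ.* seq y n ℚ.+ ε ∎)
    b (eventually₂ (λ _ → _,_) (p δ 0<δ) (q δ 0<δ))
  where
  open +-*-Solver
  factor : ∀ a b c → a ℚ.* b ℚ.- a ℚ.* c ≡ a ℚ.* (b ℚ.- c)
  factor = solve 3 (λ a b c → a :* b :- a :* c := a :* (b :- c)) refl

*-comm : ∀ x y → x * y ≈ y * x
*-comm x y = ≈-pointwise λ n → ℚ.*-comm (seq x n) (seq y n)

*-congˡ : ∀ z {x y} → x ≈ y → z * x ≈ z * y
*-congˡ z {x} {y} x≈y = *-congˡ-≤ z {x} {y} x≈y , *-congˡ-≤ z {y} {x} (swap x≈y)

*-cong : ∀ {x y u v} → x ≈ y → u ≈ v → x * u ≈ y * v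
*-cong {x} {y} {u} {v} x≈y u≈v =
  ℝ-≤.Eq.trans {x * u} {x * v} {y * v} (*-congˡ x {u} {v} u≈v)
    (ℝ-≤.Eq.trans {x * v} {v * x} {y * v} (*-comm x v)
      (ℝ-≤.Eq.trans {v * x} {v * y} {y * v} (*-congˡ v {x} {y} x≈y) (*-comm v y)))

-- Abstract because comparing terms built from _+_ and _*_ themselves unfolds
-- the arithmetic of ℚ, at exponential cost.
abstract
  infixl 6 _⊕_
  infixl 7 _⊗_

  _⊕_ _⊗_ : ℝ → ℝ → ℝ
  _⊕_ = _+_
  _⊗_ = _*_

  ⊕≡+ : _⊕_ ≡ _+_
  ⊕≡+ = refl

  ⊗≡* : _⊗_ ≡ _*_
  ⊗≡* = refl

  ⊕-mono-≤ : ∀ {x y u v} → x ≤ y → u ≤ v → x ⊕ u ≤ y ⊕ v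
  ⊕-mono-≤ = +-mono-≤

  isCommutativeSemiring : IsCommutativeSemiring _≈_ _⊕_ _⊗_ 0ℝ 1ℝ
  isCommutativeSemiring = IsCommutativeSemiringˡ.isCommutativeSemiring record
    { +-isCommutativeMonoid = record
      { isMonoid = record
        { isSemigroup = record
          { isMagma = record
            { isEquivalence = ℝ-≤.isEquivalence
            ; ∙-cong = λ (p , q) (r , s) → +-mono-≤ p r , +-mono-≤ q s
            }
          ; assoc = λ x y z → ≈-pointwise λ n → ℚ.+-assoc (seq x n) (seq y n) (seq z n)
          }
        ; identity = (λ x → ≈-pointwise λ n → ℚ.+-identityˡ (seq x n))
                   , (λ x → ≈-pointwise λ n → ℚ.+-identityʳ (seq x n))
        }
      ; comm = λ x y → ≈-pointwise λ n → ℚ.+-comm (seq x n) (seq y n)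
      }
    ; *-isCommutativeMonoid = record
      { isMonoid = record
        { isSemigroup = record
          { isMagma = record
            { isEquivalence = ℝ-≤.isEquivalence
            ; ∙-cong = *-cong
            }
          ; assoc = λ x y z → ≈-pointwise λ n → ℚ.*-assoc (seq x n) (seq y n) (seq z n)
          }
        ; identity = (λ x → ≈-pointwise λ n → ℚ.*-identityˡ (seq x n))
                   , (λ x → ≈-pointwise λ n → ℚ.*-identityʳ (seq x n))
        }
      ; comm = *-comm
      }
    ; distribʳ = λ z x y → ≈-pointwise λ n → ℚ.*-distribʳ-+ (seq z n) (seq x n) (seq y n)
    ; zeroˡ = λ x → ≈-pointwise λ n → ℚ.*-zeroˡ (seq x n)
    }

fromℚ-mono-≤ : ∀ {p q} → p ℚ.≤ q → fromℚ p ≤ fromℚ q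
fromℚ-mono-≤ p≤q = ≤-pointwise λ _ → p≤q

-- If q < p, half their distance is an error the definition of _≤_ excludes.
fromℚ-cancel-≤ : ∀ {p q} → fromℚ p ≤ fromℚ q → p ℚ.≤ q
fromℚ-cancel-≤ {p} {q} (mk≤ h) with p ℚ.≤? q
... | yes p≤q = p≤q
... | no p≰q = contradiction p<p (ℚ.<-irrefl refl)
  where
  open +-*-Solver
  open ℚ.≤-Reasoning
  0<p-q : 0ℚ ℚ.< p ℚ.- q
  0<p-q = subst (ℚ._< p ℚ.- q) (ℚ.+-inverseʳ q) (ℚ.+-monoˡ-< (ℚ.- q) (ℚ.≰⇒> p≰q))
  cancel : ∀ p q → q ℚ.+ (p ℚ.- q) ≡ p
  cancel = solve 2 (λ p q → q :+ (p :- q) := p) refl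
  δ = ½ ℚ.* (p ℚ.- q)
  0<δ : 0ℚ ℚ.< δ
  0<δ = 0<½ε 0<p-q
  N = proj₁ (h δ 0<δ)
  p<p : p ℚ.< p
  p<p = begin-strict
    p                      ≤⟨ proj₂ (h δ 0<δ) N ℕ.≤-refl ⟩
    q ℚ.+ δ                ≡⟨ ℚ.+-identityʳ (q ℚ.+ δ) ⟨
    q ℚ.+ δ ℚ.+ 0ℚ         <⟨ ℚ.+-monoʳ-< (q ℚ.+ δ) 0<δ ⟩
    q ℚ.+ δ ℚ.+ δ          ≡⟨ ℚ.+-assoc q δ δ ⟩
    q ℚ.+ (δ ℚ.+ δ)        ≡⟨ cong (q ℚ.+_) (½ε+½ε≡ε (p ℚ.- q)) ⟩
    q ℚ.+ (p ℚ.- q)        ≡⟨ cancel p q ⟩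
    p                      ∎

*-monoˡ-≤-fromℚ : ∀ {c x y} → 0ℚ ℚ.≤ c → x ≤ y → fromℚ c * x ≤ fromℚ c * y
*-monoˡ-≤-fromℚ {c} {x} {y} 0≤c (mk≤ h) = mk≤ λ ε 0<ε →
  let δ , 0<δ , [1+c]δ≡ε = divide {1ℚ ℚ.+ c} (ℚ.+-mono-<-≤ {0ℚ} {1ℚ} {0ℚ} 0<1ℚ 0≤c) 0<ε in
  eventually-map (λ n x≤y → let open ℚ.≤-Reasoning in begin
    c ℚ.* seq x n                      ≤⟨ ℚ.*-monoˡ-≤-nonNeg c {{nonNegative 0≤c}} x≤y ⟩
    c ℚ.* (seq y n ℚ.+ δ)              ≡⟨ ℚ.*-distribˡ-+ c (seq y n) δ ⟩
    c ℚ.* seq y n ℚ.+ c ℚ.* δ          ≤⟨ ℚ.+-monoʳ-≤ (c ℚ.* seq y n)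
                                            (ℚ.*-monoʳ-≤-nonNeg δ {{nonNegative (ℚ.<⇒≤ 0<δ)}} c≤1+c) ⟩
    c ℚ.* seq y n ℚ.+ (1ℚ ℚ.+ c) ℚ.* δ ≡⟨ cong (c ℚ.* seq y n ℚ.+_) [1+c]δ≡ε ⟩
    c ℚ.* seq y n ℚ.+ ε                ∎)
    (h δ 0<δ)
  where
  c≤1+c : c ℚ.≤ 1ℚ ℚ.+ c
  c≤1+c = subst (ℚ._≤ 1ℚ ℚ.+ c) (ℚ.+-identityˡ c) (ℚ.+-monoˡ-≤ c (ℚ.<⇒≤ 0<1ℚ))

-- With |x₁ - x₂|, |y₁ - y₂| ≤ η past N, comparing the N-th terms with
-- tolerance 3η either gives y ≤ x up to 5η or the gap η of x < y.
≮⇒≥ : ∀ {x y} → ¬ (x < y) → y ≤ x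
≮⇒≥ {x} {y} x≮y = mk≤ λ ε 0<ε →
  let
    η , 0<η , 5η≡ε = divide {1ℚ ℚ.+ 1ℚ ℚ.+ 1ℚ ℚ.+ 1ℚ ℚ.+ 1ℚ} (ℚ.positive⁻¹ _) 0<ε
    M , p = cauchy x η 0<η
    N , q = cauchy y η 0<η
  in compare ε η 0<η 5η≡ε (M ℕ.⊔ N)
       (λ m n h k → p m n (ℕ.m⊔n≤o⇒m≤o M N h) (ℕ.m⊔n≤o⇒m≤o M N k))
       (λ m n h k → q m n (ℕ.m⊔n≤o⇒n≤o M N h) (ℕ.m⊔n≤o⇒n≤o M N k))
  where
  open +-*-Solver
  near : ∀ z {N η} → (∀ m n → N ℕ.≤ m → N ℕ.≤ n → ∣ seq z m ℚ.- seq z n ∣ ℚ.≤ η) →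
         ∀ {m n} → N ℕ.≤ m → N ℕ.≤ n → seq z m ℚ.≤ seq z n ℚ.+ η
  near z h {m} {n} i j =
    ℚ.≤-trans (p≤q+∣p-q∣ (seq z m) (seq z n)) (ℚ.+-monoʳ-≤ (seq z n) (h m n i j))

  compare : ∀ ε η → 0ℚ ℚ.< η → (1ℚ ℚ.+ 1ℚ ℚ.+ 1ℚ ℚ.+ 1ℚ ℚ.+ 1ℚ) ℚ.* η ≡ ε → ∀ N →
            (∀ m n → N ℕ.≤ m → N ℕ.≤ n → ∣ seq x m ℚ.- seq x n ∣ ℚ.≤ η) →
            (∀ m n → N ℕ.≤ m → N ℕ.≤ n → ∣ seq y m ℚ.- seq y n ∣ ℚ.≤ η) →
            Eventually λ n → seq y n ℚ.≤ seq x n ℚ.+ ε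
  compare ε η 0<η 5η≡ε N p q with seq y N ℚ.≤? seq x N ℚ.+ η ℚ.+ η ℚ.+ η
  ... | yes close = N , λ n N≤n → begin
    seq y n                               ≤⟨ near y q N≤n ℕ.≤-refl ⟩
    seq y N ℚ.+ η                         ≤⟨ ℚ.+-monoˡ-≤ η close ⟩
    seq x N ℚ.+ η ℚ.+ η ℚ.+ η ℚ.+ η       ≤⟨ add (add (add (add (near x p ℕ.≤-refl N≤n)))) ⟩
    seq x n ℚ.+ η ℚ.+ η ℚ.+ η ℚ.+ η ℚ.+ η ≡⟨ five (seq x n) η ⟩
    seq x n ℚ.+ (1ℚ ℚ.+ 1ℚ ℚ.+ 1ℚ ℚ.+ 1ℚ ℚ.+ 1ℚ) ℚ.* η ≡⟨ cong (seq x n ℚ.+_) 5η≡ε ⟩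
    seq x n ℚ.+ ε                         ∎
    where
    open ℚ.≤-Reasoning
    add : ∀ {a b} → a ℚ.≤ b → a ℚ.+ η ℚ.≤ b ℚ.+ η
    add = ℚ.+-monoˡ-≤ η
    five : ∀ a η → a ℚ.+ η ℚ.+ η ℚ.+ η ℚ.+ η ℚ.+ η ≡
                   a ℚ.+ (1ℚ ℚ.+ 1ℚ ℚ.+ 1ℚ ℚ.+ 1ℚ ℚ.+ 1ℚ) ℚ.* η
    five = solve 2 (λ a η → a :+ η :+ η :+ η :+ η :+ η :=
      a :+ (con 1ℚ :+ con 1ℚ :+ con 1ℚ :+ con 1ℚ :+ con 1ℚ) :* η) refl
  ... | no apart = contradiction (mk< η 0<η (N , λ n N≤n → begin
    seq x n ℚ.+ η                   ≤⟨ ℚ.+-monoˡ-≤ η (near x p N≤n ℕ.≤-refl) ⟩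
    seq x N ℚ.+ η ℚ.+ η             ≡⟨ cancel (seq x N ℚ.+ η ℚ.+ η) η ⟩
    (seq x N ℚ.+ η ℚ.+ η ℚ.+ η) ℚ.- η ≤⟨ ℚ.+-monoˡ-≤ (ℚ.- η) (ℚ.<⇒≤ (ℚ.≰⇒> apart)) ⟩
    seq y N ℚ.- η                   ≤⟨ ℚ.+-monoˡ-≤ (ℚ.- η) (near y q ℕ.≤-refl N≤n) ⟩
    (seq y n ℚ.+ η) ℚ.- η           ≡⟨ cancel (seq y n) η ⟨
    seq y n                         ∎)) x≮y
    where
    open ℚ.≤-Reasoning
    cancel : ∀ a η → a ≡ (a ℚ.+ η) ℚ.- η
    cancel = solve 2 (λ a η → a := (a :+ η) :- η) refl

abstract
  fromℚ-⊕ : ∀ p q → fromℚ p ⊕ fromℚ q ≈ fromℚ (p ℚ.+ q)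
  fromℚ-⊕ p q = ≈-pointwise λ _ → refl

  fromℚ-⊗ : ∀ p q → fromℚ p ⊗ fromℚ q ≈ fromℚ (p ℚ.* q)
  fromℚ-⊗ p q = ≈-pointwise λ _ → refl

  fromℚ-⊗-monoʳ-≤ : ∀ {c} → 0ℚ ℚ.≤ c → ∀ {x y} → x ≤ y → fromℚ c ⊗ x ≤ fromℚ c ⊗ y
  fromℚ-⊗-monoʳ-≤ {c} 0≤c {x} {y} = *-monoˡ-≤-fromℚ {c} {x} {y} 0≤c

  x⊕q≰x : ∀ x {q} → 0ℚ ℚ.< q → ¬ (x ⊕ fromℚ q ≤ x)
  x⊕q≰x x {q} 0<q (mk≤ h) with h (½ ℚ.* q) (0<½ε 0<q)
  ... | N , p = ℚ.<-irrefl refl (begin-strict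
    q                                 ≡⟨ cancel (seq x N) q ⟩
    (seq x N ℚ.+ q) ℚ.- seq x N       ≤⟨ ℚ.+-monoˡ-≤ (ℚ.- seq x N) (p N ℕ.≤-refl) ⟩
    (seq x N ℚ.+ ½ ℚ.* q) ℚ.- seq x N ≡⟨ cancel (seq x N) (½ ℚ.* q) ⟨
    ½ ℚ.* q                           ≡⟨ ℚ.+-identityʳ (½ ℚ.* q) ⟨
    ½ ℚ.* q ℚ.+ 0ℚ                    <⟨ ℚ.+-monoʳ-< (½ ℚ.* q) (0<½ε 0<q) ⟩
    ½ ℚ.* q ℚ.+ ½ ℚ.* q               ≡⟨ ½ε+½ε≡ε q ⟩
    q                                 ∎)
    where
    open ℚ.≤-Reasoning
    open +-*-Solver
    cancel : ∀ a q → q ≡ (a ℚ.+ q) ℚ.- a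
    cancel = solve 2 (λ a q → q := (a :+ q) :- a) refl

  -- y - z ≤ K (y - x), written without subtraction.
  archimedean : ∀ {x y} z → x < y →
                ∃[ K ] 0ℚ ℚ.≤ K × fromℚ K ⊗ x ⊕ y ≤ fromℚ K ⊗ y ⊕ z
  archimedean {x} {y} z (mk< gap 0<gap x<y) =
    let
      B , 0<B , ∣y∣≤B = bounded y
      C , 0<C , ∣z∣≤C = bounded z
      K , 0<K , gap*K≡B+C = divide 0<gap (ℚ.+-mono-< 0<B 0<C)
    in K , ℚ.<⇒≤ 0<K , mk≤ λ ε 0<ε → eventually₂ (λ n x+gap≤y (∣y∣≤B , ∣z∣≤C) → begin
      K ℚ.* seq x n ℚ.+ seq y n
        ≤⟨ ℚ.+-monoʳ-≤ (K ℚ.* seq x n) (ℚ.≤-trans (p≤∣p∣ (seq y n)) ∣y∣≤B) ⟩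
      K ℚ.* seq x n ℚ.+ B
        ≡⟨ move K (seq x n) B C ⟩
      K ℚ.* seq x n ℚ.+ (B ℚ.+ C) ℚ.+ ℚ.- C
        ≡⟨ cong (λ t → K ℚ.* seq x n ℚ.+ t ℚ.+ ℚ.- C) gap*K≡B+C ⟨
      K ℚ.* seq x n ℚ.+ gap ℚ.* K ℚ.+ ℚ.- C
        ≡⟨ cong (ℚ._+ ℚ.- C) (factor K (seq x n) gap) ⟩
      K ℚ.* (seq x n ℚ.+ gap) ℚ.+ ℚ.- C
        ≤⟨ ℚ.+-mono-≤ (ℚ.*-monoˡ-≤-nonNeg K {{nonNegative (ℚ.<⇒≤ 0<K)}} x+gap≤y)
             (-C≤ (seq z n) ∣z∣≤C) ⟩
      K ℚ.* seq y n ℚ.+ seq z n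
        ≡⟨ ℚ.+-identityʳ (K ℚ.* seq y n ℚ.+ seq z n) ⟨
      K ℚ.* seq y n ℚ.+ seq z n ℚ.+ 0ℚ
        ≤⟨ ℚ.+-monoʳ-≤ (K ℚ.* seq y n ℚ.+ seq z n) (ℚ.<⇒≤ 0<ε) ⟩
      K ℚ.* seq y n ℚ.+ seq z n ℚ.+ ε ∎)
      x<y (eventually₂ (λ _ → _,_) ∣y∣≤B ∣z∣≤C)
    where
    open ℚ.≤-Reasoning
    open +-*-Solver
    move : ∀ K x B C → K ℚ.* x ℚ.+ B ≡ K ℚ.* x ℚ.+ (B ℚ.+ C) ℚ.+ ℚ.- C
    move = solve 4 (λ K x B C → K :* x :+ B := K :* x :+ (B :+ C) :+ :- C) refl
    factor : ∀ K x g → K ℚ.* x ℚ.+ g ℚ.* K ≡ K ℚ.* (x ℚ.+ g)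
    factor = solve 3 (λ K x g → K :* x :+ g :* K := K :* (x :+ g)) refl
    -C≤ : ∀ z {C} → ∣ z ∣ ℚ.≤ C → ℚ.- C ℚ.≤ z
    -C≤ z {C} ∣z∣≤C = begin
      ℚ.- C           ≤⟨ ℚ.neg-antimono-≤ ∣z∣≤C ⟩
      ℚ.- ∣ z ∣       ≡⟨ cong ℚ.-_ (ℚ.∣-p∣≡∣p∣ z) ⟨
      ℚ.- ∣ ℚ.- z ∣   ≤⟨ ℚ.neg-antimono-≤ (p≤∣p∣ (ℚ.- z)) ⟩
      ℚ.- (ℚ.- z)     ≡⟨ double-neg z ⟩
      z               ∎
      where
      double-neg : ∀ z → ℚ.- (ℚ.- z) ≡ z
      double-neg = solve 1 (λ z → :- (:- z) := z) refl

-- Points beyond a face of the stable set polytope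

ℝ-orderedSemiring : OrderedSemiring
ℝ-orderedSemiring = record
  { commutativeSemiring = record { isCommutativeSemiring = isCommutativeSemiring }
  ; _≤_ = _≤_
  ; isPartialOrder = ℝ-≤.isPartialOrder
  ; +-mono-≤ = ⊕-mono-≤
  }

module V = Combinations ℝ-orderedSemiring
module R = OrderedSemiring ℝ-orderedSemiring

sum≡ : ∀ {k} (x : Vector ℝ k) → sum x ≡ Vector.foldr _⊕_ 0ℝ x
sum≡ x = cong (λ _∔_ → Vector.foldr _∔_ 0ℝ x) {_+_} {_⊕_} (sym ⊕≡+)

comb≡ : ∀ {J d} (w : Vector ℝ J) (p : Fin J → Vector ℝ d) i →
        (sum λ j → w j * p j i) ≡ V.comb w p i
comb≡ w p i = cong₂ (λ _∔_ _·_ → Vector.foldr _∔_ 0ℝ λ j → w j · p j i)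
  {_+_} {_⊕_} {_*_} {_⊗_} (sym ⊕≡+) (sym ⊗≡*)

∙≡ : ∀ {r d} (M : Matrix r d) x i → (M ∙ x) i ≡ (M V.∙ x) i
∙≡ M x i = cong₂ (λ _∔_ _·_ → Vector.foldr _∔_ 0ℝ λ j → M i j · x j)
  {_+_} {_⊕_} {_*_} {_⊗_} (sym ⊕≡+) (sym ⊗≡*)

+≡⊕ : ∀ {x y u v} → x ≡ u → y ≡ v → x + y ≡ u ⊕ v
+≡⊕ {x} {y} refl refl = cong (λ _∔_ → x ∔ y) {_+_} {_⊕_} (sym ⊕≡+)

row≡ : ∀ {r d k} (E : Matrix r d) (F : Matrix r k) x y i →
       (E ∙ x) i + (F ∙ y) i ≡ (E V.∙ x) i ⊕ (F V.∙ y) i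
row≡ E F x y i =
  +≡⊕ {(E ∙ x) i} {(F ∙ y) i} {(E V.∙ x) i} {(F V.∙ y) i} (∙≡ E x i) (∙≡ F y i)

0≤1 : 0ℝ ≤ 1ℝ
0≤1 = fromℚ-mono-≤ (ℚ.<⇒≤ 0<1ℚ)

module _ {d k} (Q : System d k) where
  open System Q

  satisfies : ∀ x y → (∀ i → (E⁼ V.∙ x) i ⊕ (F⁼ V.∙ y) i ≈ g⁼ i) →
              (∀ i → (E≤ V.∙ x) i ⊕ (F≤ V.∙ y) i ≤ g≤ i) → Satisfies x y
  satisfies x y equations inequalities =
    (λ i → subst (_≈ g⁼ i) {(E⁼ V.∙ x) i ⊕ (F⁼ V.∙ y) i} {(E⁼ ∙ x) i + (F⁼ ∙ y) i}
      (sym (row≡ E⁼ F⁼ x y i)) (equations i)) ,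
    (λ i → subst (_≤ g≤ i) {(E≤ V.∙ x) i ⊕ (F≤ V.∙ y) i} {(E≤ ∙ x) i + (F≤ ∙ y) i}
      (sym (row≡ E≤ F≤ x y i)) (inequalities i))

  satisfies⁻¹ : ∀ x y → Satisfies x y → (∀ i → (E⁼ V.∙ x) i ⊕ (F⁼ V.∙ y) i ≈ g⁼ i) ×
                (∀ i → (E≤ V.∙ x) i ⊕ (F≤ V.∙ y) i ≤ g≤ i)
  satisfies⁻¹ x y (equations , inequalities) =
    (λ i → subst (_≈ g⁼ i) {(E⁼ ∙ x) i + (F⁼ ∙ y) i} {(E⁼ V.∙ x) i ⊕ (F⁼ V.∙ y) i}
      (row≡ E⁼ F⁼ x y i) (equations i)) ,
    (λ i → subst (_≤ g≤ i) {(E≤ ∙ x) i + (F≤ ∙ y) i} {(E≤ V.∙ x) i ⊕ (F≤ V.∙ y) i}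
      (row≡ E≤ F≤ x y i) (inequalities i))

STAB-bound : ∀ {n} (G : Graph n) l β → (∀ S → Stable G S → count (lookup S) l ℕ.≤ β) →
             ∀ {x} → STAB G x → V.listSum l x ≤ V.nat β
STAB-bound G l β valid {x} (J , p , w , vertices , 0≤w , ∑w≈1 , x≈comb) =
  V.convex-bound l β w p 0≤w (subst (_≈ 1ℝ) (sum≡ w) ∑w≈1)
    (λ j → let S , stable , pⱼ≈χS = vertices j in
      count (lookup S) l , valid S stable ,
      R.trans (V.listSum-cong l pⱼ≈χS) (V.listSum-indicator (lookup S) l))
    x (λ v → subst (x v ≈_) (comb≡ w p v) (x≈comb v))

χ∈STAB : ∀ {n} (G : Graph n) {S} → Stable G S → STAB G (χ S)
χ∈STAB G {S} stable =
  1 , (λ _ → χ S) , (λ _ → 1ℝ)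
  , (λ _ → S , stable , λ i → R.refl)
  , (λ _ → 0≤1)
  , subst (_≈ 1ℝ) (sym (sum≡ {1} λ _ → 1ℝ)) (R.+-identityʳ 1ℝ)
  , λ i → subst (χ S i ≈_) (sym (comb≡ {1} (λ _ → 1ℝ) (λ _ → χ S) i))
      (R.sym (R.trans (R.+-identityʳ (1ℝ ⊗ χ S i)) (R.*-identityˡ (χ S i))))

sum-fromℚ : ∀ {k} (q : Vector ℚ k) →
            Vector.foldr _⊕_ 0ℝ (fromℚ ∘ q) ≈ fromℚ (Vector.foldr ℚ._+_ 0ℚ q)
sum-fromℚ {zero}  q = R.refl
sum-fromℚ {suc k} q = R.trans (R.+-congˡ (sum-fromℚ (q ∘ suc))) (fromℚ-⊕ (q zero) _)

sum-nonNegative : ∀ {k} (q : Vector ℚ k) → (∀ j → 0ℚ ℚ.≤ q j) → 0ℚ ℚ.≤ Vector.foldr ℚ._+_ 0ℚ q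
sum-nonNegative {zero}  q 0≤q = ℚ.≤-refl
sum-nonNegative {suc k} q 0≤q = ℚ.+-mono-≤ (0≤q zero) (sum-nonNegative (q ∘ suc) (0≤q ∘ suc))

module _ {n k} (G : Graph n) (Q : System n k) (ef : Q IsExtendedFormulationOf STAB G) where
  open System Q

  abstract
    lift : ∀ {S} → Stable G S → ∃[ y ] Satisfies (χ S) y
    lift {S} stable = Equivalence.to (ef (χ S)) (χ∈STAB G stable)

  activity : ∀ {S} → Stable G S → Fin #ineq → ℝ
  activity {S} stable i = (E≤ V.∙ χ S) i ⊕ (F≤ V.∙ proj₁ (lift stable)) i

  activity≤g : ∀ {S} (stable : Stable G S) i → activity stable i ≤ g≤ i
  activity≤g {S} stable i = proj₂ (satisfies⁻¹ Q (χ S) (proj₁ (lift stable)) (proj₂ (lift stable))) i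

  -- The point u (2 χ^{S₁} + ∑ Kⱼ χ^{Sⱼ₊₂} − χ^{S₀}), where u normalises the weights,
  -- satisfies Q by the hypothesis on the slacks, but violates the inequality
  -- listSum l x ≤ β, which S₁, S₂, … satisfy with equality and S₀ strictly.
  no-extrapolation : ∀ l β → (∀ S → Stable G S → count (lookup S) l ℕ.≤ β) →
    ∀ {r} (S : Fin (suc (suc r)) → Subset n) (stable : ∀ j → Stable G (S j)) →
    count (lookup (S zero)) l ℕ.< β → (∀ j → count (lookup (S (suc j))) l ≡ β) →
    (K : Fin r → ℚ) → (∀ j → 0ℚ ℚ.≤ K j) →
    (∀ i → ∃[ j ] fromℚ (K j) ⊗ activity (stable (suc (suc j))) i ⊕ g≤ i ≤
                  fromℚ (K j) ⊗ g≤ i ⊕ activity (stable zero) i) → ⊥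
  no-extrapolation l β valid {r} S stable S₀<β S≡β K 0≤K slack =
    let u , 0<u , [1+∑K]u≡1 = divide (ℚ.+-mono-<-≤ {0ℚ} {1ℚ} {0ℚ} 0<1ℚ (sum-nonNegative K 0≤K)) 0<1ℚ
    in violation u 0<u [1+∑K]u≡1
    where
    ∑K = Vector.foldr ℚ._+_ 0ℚ K

    κ : Vector ℚ (suc r)
    κ zero    = 1ℚ ℚ.+ 1ℚ
    κ (suc j) = K j

    0≤κ : ∀ j → 0ℚ ℚ.≤ κ j
    0≤κ zero    = ℚ.nonNegative⁻¹ (1ℚ ℚ.+ 1ℚ)
    0≤κ (suc j) = 0≤K j

    X : Fin (suc (suc r)) → Vector ℝ n
    X j = χ (S j)

    Y : Fin (suc (suc r)) → Vector ℝ k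
    Y j = proj₁ (lift (stable j))

    module _ (u : ℚ) (0<u : 0ℚ ℚ.< u) ([1+∑K]u≡1 : (1ℚ ℚ.+ ∑K) ℚ.* u ≡ 1ℚ) where
      -u+u≈0 : fromℚ (ℚ.- u) ⊕ fromℚ u ≈ 0ℝ
      -u+u≈0 = R.trans (fromℚ-⊕ (ℚ.- u) u) (R.reflexive (cong fromℚ (ℚ.+-inverseˡ u)))

      u*∑κ≈1+u : fromℚ u ⊗ Vector.foldr _⊕_ 0ℝ (fromℚ ∘ κ) ≈ 1ℝ ⊕ fromℚ u
      u*∑κ≈1+u = R.trans (R.*-congˡ (sum-fromℚ κ)) (R.trans (fromℚ-⊗ u _)
        (R.trans (R.reflexive (cong fromℚ u*∑κ≡1+u)) (R.sym (fromℚ-⊕ 1ℚ u))))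
        where
        open +-*-Solver
        expand : ∀ u K → u ℚ.* (1ℚ ℚ.+ 1ℚ ℚ.+ K) ≡ (1ℚ ℚ.+ K) ℚ.* u ℚ.+ u
        expand = solve 2 (λ u K → u :* (con 1ℚ :+ con 1ℚ :+ K) := (con 1ℚ :+ K) :* u :+ u) refl
        u*∑κ≡1+u : u ℚ.* (1ℚ ℚ.+ 1ℚ ℚ.+ ∑K) ≡ 1ℚ ℚ.+ u
        u*∑κ≡1+u = trans (expand u ∑K) (cong (ℚ._+ u) [1+∑K]u≡1)

      open V.Extrapolation (fromℚ ∘ κ) -u+u≈0 u*∑κ≈1+u (fromℚ-⊗-monoʳ-≤ (ℚ.<⇒≤ 0<u))

      z : Vector ℝ n
      z = V.comb weights X

      y : Vector ℝ k
      y = V.comb weights Y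

      equations : ∀ i → (E⁼ V.∙ z) i ⊕ (F⁼ V.∙ y) i ≈ g⁼ i
      equations i = R.trans (V.∙+∙-comb E⁼ F⁼ weights X Y i)
        (extrapolate-≈ (λ j → (E⁼ V.∙ X j) i ⊕ (F⁼ V.∙ Y j) i) (g⁼ i) λ j →
          proj₁ (satisfies⁻¹ Q (χ (S j)) (proj₁ (lift (stable j))) (proj₂ (lift (stable j)))) i)

      inequalities : ∀ i → (E≤ V.∙ z) i ⊕ (F≤ V.∙ y) i ≤ g≤ i
      inequalities i = V.≤.trans (V.≤.reflexive (V.∙+∙-comb E≤ F≤ weights X Y i))
        (extrapolate-slack (λ j → activity (stable j) i) (g≤ i)
          (λ j → fromℚ-⊗-monoʳ-≤ (0≤κ j) (activity≤g (stable (suc j)) i))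
          (suc (proj₁ (slack i))) (proj₂ (slack i)))

      z∈STAB : STAB G z
      z∈STAB = Equivalence.from (ef z) (y , satisfies Q z y equations inequalities)

      beyond : V.nat β ⊕ fromℚ u ≤ V.listSum l z
      beyond = V.≤.trans
        (extrapolate-beyond (λ j → V.listSum l (X j)) (V.nat β)
          (λ j → R.trans (V.listSum-indicator (lookup (S (suc j))) l)
                   (R.reflexive (cong V.nat (S≡β j))))
          (V.≤.trans (V.≤.reflexive (R.trans (R.+-congʳ (V.listSum-indicator (lookup (S zero)) l)) (R.+-comm _ 1ℝ)))
                     (V.nat-mono-≤ 0≤1 S₀<β)))
        (V.≤.reflexive (R.sym (V.listSum-comb l weights X)))

      violation : ⊥
      violation = x⊕q≰x (V.nat β) 0<u (V.≤.trans beyond (STAB-bound G l β valid z∈STAB))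

-- Rectangle covers of the disjointness matrix

sumDisjoint : ∀ m → (Subset m → Subset m → ℕ) → ℕ
sumDisjoint zero    f = f [] []
sumDisjoint (suc m) f = sumDisjoint m λ a b →
  f (false ∷ a) (false ∷ b) ℕ.+ f (true ∷ a) (false ∷ b) ℕ.+ f (false ∷ a) (true ∷ b)

sumDisjoint-mono : ∀ m {f g} → (∀ a b → card (a ∩ b) ≡ 0 → f a b ℕ.≤ g a b) →
                   sumDisjoint m f ℕ.≤ sumDisjoint m g
sumDisjoint-mono zero    h = h [] [] refl
sumDisjoint-mono (suc m) h = sumDisjoint-mono m λ a b a∩b≡∅ →
  ℕ.+-mono-≤ (ℕ.+-mono-≤ (h (false ∷ a) (false ∷ b) a∩b≡∅) (h (true ∷ a) (false ∷ b) a∩b≡∅))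
             (h (false ∷ a) (true ∷ b) a∩b≡∅)

sumDisjoint-+ : ∀ m f g →
  sumDisjoint m (λ a b → f a b ℕ.+ g a b) ≡ sumDisjoint m f ℕ.+ sumDisjoint m g
sumDisjoint-+ zero    f g = refl
sumDisjoint-+ (suc m) f g = trans (ℕ.≤-antisym
    (sumDisjoint-mono m λ a b _ → ℕ.≤-reflexive (interchange (f (false ∷ a) (false ∷ b)) _ _ _ _ _))
    (sumDisjoint-mono m λ a b _ → ℕ.≤-reflexive (sym (interchange (f (false ∷ a) (false ∷ b)) _ _ _ _ _))))
  (sumDisjoint-+ m _ _)
  where
  interchange : ∀ a b c d e f →
    (a ℕ.+ b) ℕ.+ (c ℕ.+ d) ℕ.+ (e ℕ.+ f) ≡ (a ℕ.+ c ℕ.+ e) ℕ.+ (b ℕ.+ d ℕ.+ f)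
  interchange = solve-∀

sumDisjoint-const : ∀ m k → sumDisjoint m (λ _ _ → k) ≡ 3 ℕ.^ m ℕ.* k
sumDisjoint-const zero    k = sym (ℕ.*-identityˡ k)
sumDisjoint-const (suc m) k = trans (sumDisjoint-const m (k ℕ.+ k ℕ.+ k)) (triple (3 ℕ.^ m) k)
  where
  triple : ∀ t k → t ℕ.* (k ℕ.+ k ℕ.+ k) ≡ 3 ℕ.* t ℕ.* k
  triple = solve-∀

Avoids1 : ∀ {m} (A B : Subset m → Bool) → Set
Avoids1 A B = ∀ a b → T (A a) → T (B b) → card (a ∩ b) ≢ 1

-- A₀, A₁ (B₀, B₁) record whether a (b) extended by 0, by 1 lies in the rectangle.
split-rectangle : ∀ A₀ A₁ B₀ B₁ → (T A₁ → T B₁ → ⊥) →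
  ⟦ A₀ ∧ B₀ ⟧ ℕ.+ ⟦ A₁ ∧ B₀ ⟧ ℕ.+ ⟦ A₀ ∧ B₁ ⟧ ℕ.≤
  ⟦ (A₀ ∨ A₁) ∧ B₀ ⟧ ℕ.+ ⟦ A₀ ∧ (B₀ ∨ B₁) ⟧
split-rectangle _     true  _     true  h = contradiction tt (h tt)
split-rectangle false false _     _     _ = z≤n
split-rectangle true  false false false _ = z≤n
split-rectangle true  false false true  _ = s≤s z≤n
split-rectangle true  false true  false _ = s≤s z≤n
split-rectangle true  false true  true  _ = s≤s (s≤s z≤n)
split-rectangle false true  false false _ = z≤n
split-rectangle false true  true  false _ = s≤s z≤n
split-rectangle true  true  false false _ = z≤n
split-rectangle true  true  true  false _ = s≤s (s≤s z≤n)

rectangle-bound : ∀ m (A B : Subset m → Bool) → Avoids1 A B →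
                  sumDisjoint m (λ a b → ⟦ A a ∧ B b ⟧) ℕ.≤ 2 ℕ.^ m
rectangle-bound zero A B _ with A [] ∧ B []
... | true  = ℕ.≤-refl
... | false = z≤n
rectangle-bound (suc m) A B avoid = begin
  sumDisjoint (suc m) (λ a b → ⟦ A a ∧ B b ⟧)
    ≤⟨ sumDisjoint-mono m (λ a b a∩b≡∅ → split-rectangle (A₀ a) (A₁ a) (B₀ b) (B₁ b)
         λ p q → avoid (true ∷ a) (true ∷ b) p q (cong suc a∩b≡∅)) ⟩
  sumDisjoint m (λ a b → ⟦ (A₀ a ∨ A₁ a) ∧ B₀ b ⟧ ℕ.+ ⟦ A₀ a ∧ (B₀ b ∨ B₁ b) ⟧)
    ≡⟨ sumDisjoint-+ m (λ a b → ⟦ (A₀ a ∨ A₁ a) ∧ B₀ b ⟧) (λ a b → ⟦ A₀ a ∧ (B₀ b ∨ B₁ b) ⟧) ⟩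
  sumDisjoint m (λ a b → ⟦ (A₀ a ∨ A₁ a) ∧ B₀ b ⟧) ℕ.+ sumDisjoint m (λ a b → ⟦ A₀ a ∧ (B₀ b ∨ B₁ b) ⟧)
    ≤⟨ ℕ.+-mono-≤ (rectangle-bound m (λ a → A₀ a ∨ A₁ a) B₀ left) (rectangle-bound m A₀ (λ b → B₀ b ∨ B₁ b) right) ⟩
  2 ℕ.^ m ℕ.+ 2 ℕ.^ m
    ≡⟨ cong (2 ℕ.^ m ℕ.+_) (ℕ.+-identityʳ (2 ℕ.^ m)) ⟨
  2 ℕ.^ suc m ∎
  where
  open ℕ.≤-Reasoning
  A₀ = λ a → A (false ∷ a)
  A₁ = λ a → A (true ∷ a)
  B₀ = λ b → B (false ∷ b)
  B₁ = λ b → B (true ∷ b)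
  left : Avoids1 (λ a → A₀ a ∨ A₁ a) B₀
  left a b p q with Bool.T-∨ {A₀ a} .Equivalence.to p
  ... | inj₁ p₀ = avoid (false ∷ a) (false ∷ b) p₀ q
  ... | inj₂ p₁ = avoid (true ∷ a) (false ∷ b) p₁ q
  right : Avoids1 A₀ (λ b → B₀ b ∨ B₁ b)
  right a b p q with Bool.T-∨ {B₀ b} .Equivalence.to q
  ... | inj₁ q₀ = avoid (false ∷ a) (false ∷ b) p q₀
  ... | inj₂ q₁ = avoid (false ∷ a) (true ∷ b) p q₁

cover-bound : ∀ {m} R (A B : Fin R → Subset m → Bool) → (∀ i → Avoids1 (A i) (B i)) →
              (∀ a b → card (a ∩ b) ≡ 0 → ∃[ i ] T (A i a) × T (B i b)) →
              3 ℕ.^ m ℕ.≤ R ℕ.* 2 ℕ.^ m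
cover-bound {m} R A B avoid cover = begin
  3 ℕ.^ m                                ≡⟨ ℕ.*-identityʳ (3 ℕ.^ m) ⟨
  3 ℕ.^ m ℕ.* 1                          ≡⟨ sumDisjoint-const m 1 ⟨
  sumDisjoint m (λ _ _ → 1)              ≤⟨ sumDisjoint-mono m (λ a b a∩b≡∅ →
                                              let i , p , q = cover a b a∩b≡∅ in
                                              covered R A B a b i p q) ⟩
  sumDisjoint m (multiplicity R A B)     ≤⟨ total R A B avoid ⟩
  R ℕ.* 2 ℕ.^ m                          ∎
  where
  open ℕ.≤-Reasoning
  multiplicity : ∀ R (A B : Fin R → Subset m → Bool) → Subset m → Subset m → ℕ
  multiplicity R A B a b = Vector.foldr ℕ._+_ 0 λ i → ⟦ A i a ∧ B i b ⟧

  covered : ∀ R A B a b i → T (A i a) → T (B i b) → 1 ℕ.≤ multiplicity R A B a b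
  covered (suc R) A B a b zero p q with A zero a | B zero b
  ... | true | true = s≤s z≤n
  covered (suc R) A B a b (suc i) p q =
    ℕ.≤-trans (covered R (A ∘ suc) (B ∘ suc) a b i p q) (ℕ.m≤n+m _ ⟦ A zero a ∧ B zero b ⟧)

  total : ∀ R A B → (∀ i → Avoids1 (A i) (B i)) →
          sumDisjoint m (multiplicity R A B) ℕ.≤ R ℕ.* 2 ℕ.^ m
  total zero    A B avoid = ℕ.≤-reflexive (trans (sumDisjoint-const m 0) (ℕ.*-zeroʳ (3 ℕ.^ m)))
  total (suc R) A B avoid = begin
    sumDisjoint m (multiplicity (suc R) A B)
      ≡⟨ sumDisjoint-+ m (λ a b → ⟦ A zero a ∧ B zero b ⟧) (multiplicity R (A ∘ suc) (B ∘ suc)) ⟩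
    sumDisjoint m (λ a b → ⟦ A zero a ∧ B zero b ⟧) ℕ.+ sumDisjoint m (multiplicity R (A ∘ suc) (B ∘ suc))
      ≤⟨ ℕ.+-mono-≤ (rectangle-bound m (A zero) (B zero) (avoid zero)) (total R (A ∘ suc) (B ∘ suc) (avoid ∘ suc)) ⟩
    2 ℕ.^ m ℕ.+ R ℕ.* 2 ℕ.^ m ∎

[m*n]^o≡m^o*n^o : ∀ m n o → (m ℕ.* n) ℕ.^ o ≡ m ℕ.^ o ℕ.* n ℕ.^ o
[m*n]^o≡m^o*n^o m n zero    = refl
[m*n]^o≡m^o*n^o m n (suc o) =
  trans (cong (m ℕ.* n ℕ.*_) ([m*n]^o≡m^o*n^o m n o)) (interchange m n (m ℕ.^ o) (n ℕ.^ o))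
  where
  interchange : ∀ a b c d → (a ℕ.* b) ℕ.* (c ℕ.* d) ≡ (a ℕ.* c) ℕ.* (b ℕ.* d)
  interchange = solve-∀

3^m≤[1+r]2^m⇒2^a≤r^b : ∀ {m r a b} → 3 ℕ.≤ m → 3 ℕ.^ m ℕ.≤ suc r ℕ.* 2 ℕ.^ m →
                       8 ℕ.* a ℕ.≤ suc m ℕ.* b → 2 ℕ.^ a ℕ.≤ r ℕ.^ b
3^m≤[1+r]2^m⇒2^a≤r^b {m} {zero} {a} {b} 3≤m h _ = contradiction
  (ℕ.≤-trans h (ℕ.≤-reflexive (ℕ.*-identityˡ (2 ℕ.^ m))))
  (ℕ.<⇒≱ (ℕ.^-monoˡ-< m {{ℕ.>-nonZero (ℕ.≤-trans (s≤s z≤n) 3≤m)}} (ℕ.n<1+n 2)))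
3^m≤[1+r]2^m⇒2^a≤r^b {m} {r@(suc r′)} {a} {b} 3≤m h 8a≤[1+m]b =
  ℕ.*-cancelʳ-≤ (2 ℕ.^ a) (r ℕ.^ b) (2 ℕ.^ (suc m ℕ.* b)) {{ℕ.m^n≢0 2 (suc m ℕ.* b)}} (begin
    2 ℕ.^ a ℕ.* 2 ℕ.^ (suc m ℕ.* b)     ≡⟨ ℕ.^-distribˡ-+-* 2 a (suc m ℕ.* b) ⟨
    2 ℕ.^ (a ℕ.+ suc m ℕ.* b)           ≤⟨ eighth-root ⟩
    3 ℕ.^ (m ℕ.* b)                     ≡⟨ ℕ.^-*-assoc 3 m b ⟨
    (3 ℕ.^ m) ℕ.^ b                     ≤⟨ ℕ.^-monoˡ-≤ b 3^m≤r2^[1+m] ⟩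
    (r ℕ.* 2 ℕ.^ suc m) ℕ.^ b           ≡⟨ [m*n]^o≡m^o*n^o r (2 ℕ.^ suc m) b ⟩
    r ℕ.^ b ℕ.* (2 ℕ.^ suc m) ℕ.^ b     ≡⟨ cong (r ℕ.^ b ℕ.*_) (ℕ.^-*-assoc 2 (suc m) b) ⟩
    r ℕ.^ b ℕ.* 2 ℕ.^ (suc m ℕ.* b)     ∎)
  where
  open ℕ.≤-Reasoning
  3^m≤r2^[1+m] : 3 ℕ.^ m ℕ.≤ r ℕ.* 2 ℕ.^ suc m
  3^m≤r2^[1+m] = begin
    3 ℕ.^ m                  ≤⟨ h ⟩
    suc r ℕ.* 2 ℕ.^ m        ≤⟨ ℕ.*-monoˡ-≤ (2 ℕ.^ m) (ℕ.+-monoˡ-≤ r (s≤s (z≤n {r′}))) ⟩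
    (r ℕ.+ r) ℕ.* 2 ℕ.^ m    ≡⟨ double r (2 ℕ.^ m) ⟩
    r ℕ.* 2 ℕ.^ suc m        ∎
    where
    double : ∀ r t → (r ℕ.+ r) ℕ.* t ≡ r ℕ.* (2 ℕ.* t)
    double = solve-∀

  exponents : 8 ℕ.* (a ℕ.+ suc m ℕ.* b) ℕ.≤ 3 ℕ.* (4 ℕ.* (m ℕ.* b))
  exponents = begin
    8 ℕ.* (a ℕ.+ suc m ℕ.* b)                ≡⟨ ℕ.*-distribˡ-+ 8 a (suc m ℕ.* b) ⟩
    8 ℕ.* a ℕ.+ 8 ℕ.* (suc m ℕ.* b)          ≤⟨ ℕ.+-monoˡ-≤ (8 ℕ.* (suc m ℕ.* b)) 8a≤[1+m]b ⟩
    suc m ℕ.* b ℕ.+ 8 ℕ.* (suc m ℕ.* b)      ≡⟨ collect m b ⟩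
    (9 ℕ.* m ℕ.+ 3 ℕ.* 3) ℕ.* b              ≤⟨ ℕ.*-monoˡ-≤ b (ℕ.+-monoʳ-≤ (9 ℕ.* m) (ℕ.*-monoʳ-≤ 3 3≤m)) ⟩
    (9 ℕ.* m ℕ.+ 3 ℕ.* m) ℕ.* b              ≡⟨ twelve m b ⟩
    3 ℕ.* (4 ℕ.* (m ℕ.* b))                  ∎
    where
    collect : ∀ m b → suc m ℕ.* b ℕ.+ 8 ℕ.* (suc m ℕ.* b) ≡ (9 ℕ.* m ℕ.+ 3 ℕ.* 3) ℕ.* b
    collect = solve-∀
    twelve : ∀ m b → (9 ℕ.* m ℕ.+ 3 ℕ.* m) ℕ.* b ≡ 3 ℕ.* (4 ℕ.* (m ℕ.* b))
    twelve = solve-∀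

  eighth-powers : (2 ℕ.^ (a ℕ.+ suc m ℕ.* b)) ℕ.^ 8 ℕ.≤ (3 ℕ.^ (m ℕ.* b)) ℕ.^ 8
  eighth-powers = begin
    (2 ℕ.^ (a ℕ.+ suc m ℕ.* b)) ℕ.^ 8   ≡⟨ ℕ.^-*-assoc 2 (a ℕ.+ suc m ℕ.* b) 8 ⟩
    2 ℕ.^ ((a ℕ.+ suc m ℕ.* b) ℕ.* 8)   ≡⟨ cong (2 ℕ.^_) (ℕ.*-comm (a ℕ.+ suc m ℕ.* b) 8) ⟩
    2 ℕ.^ (8 ℕ.* (a ℕ.+ suc m ℕ.* b))   ≤⟨ ℕ.^-monoʳ-≤ 2 exponents ⟩
    2 ℕ.^ (3 ℕ.* (4 ℕ.* (m ℕ.* b)))     ≡⟨ ℕ.^-*-assoc 2 3 (4 ℕ.* (m ℕ.* b)) ⟨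
    8 ℕ.^ (4 ℕ.* (m ℕ.* b))             ≤⟨ ℕ.^-monoˡ-≤ (4 ℕ.* (m ℕ.* b)) (ℕ.n≤1+n 8) ⟩
    9 ℕ.^ (4 ℕ.* (m ℕ.* b))             ≡⟨ ℕ.^-*-assoc 3 2 (4 ℕ.* (m ℕ.* b)) ⟩
    3 ℕ.^ (2 ℕ.* (4 ℕ.* (m ℕ.* b)))     ≡⟨ cong (3 ℕ.^_) (eight (m ℕ.* b)) ⟩
    3 ℕ.^ (m ℕ.* b ℕ.* 8)               ≡⟨ ℕ.^-*-assoc 3 (m ℕ.* b) 8 ⟨
    (3 ℕ.^ (m ℕ.* b)) ℕ.^ 8             ∎
    where
    eight : ∀ x → 2 ℕ.* (4 ℕ.* x) ≡ x ℕ.* 8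
    eight = solve-∀

  eighth-root : 2 ℕ.^ (a ℕ.+ suc m ℕ.* b) ℕ.≤ 3 ℕ.^ (m ℕ.* b)
  eighth-root = ℕ.≮⇒≥ λ lt → ℕ.<⇒≱ (ℕ.^-monoˡ-< 8 lt) eighth-powers

-- The doubly subdivided complete graph

count-++ : ∀ {A : Set} (s : A → Bool) l l′ → count s (l ++ l′) ≡ count s l ℕ.+ count s l′
count-++ s []      l′ = refl
count-++ s (x ∷ l) l′ =
  trans (cong (⟦ s x ⟧ ℕ.+_) (count-++ s l l′)) (sym (ℕ.+-assoc ⟦ s x ⟧ (count s l) (count s l′)))

count-map : ∀ {A B : Set} (s : B → Bool) (f : A → B) l → count s (List.map f l) ≡ count (s ∘ f) l
count-map s f []      = refl
count-map s f (x ∷ l) = cong (⟦ s (f x) ⟧ ℕ.+_) (count-map s f l)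

count-cong : ∀ {A : Set} {s t : A → Bool} → s ≗ t → ∀ l → count s l ≡ count t l
count-cong s≗t []      = refl
count-cong s≗t (x ∷ l) = cong₂ (λ b k → ⟦ b ⟧ ℕ.+ k) (s≗t x) (count-cong s≗t l)

-- The cells I × I of a square are the vertices of the complete graph on I with
-- each edge subdivided twice: the diagonal cells (i , i) are the original
-- vertices, and i, j are joined by the path (i , i), (i , j), (j , i), (j , j).
module _ {I : Set} where

  data Adjacent : I × I → I × I → Set where
    diag-off : ∀ {i j} → i ≢ j → Adjacent (i , i) (i , j)
    off-diag : ∀ {i j} → i ≢ j → Adjacent (i , j) (i , i)
    off-off  : ∀ {i j} → i ≢ j → Adjacent (i , j) (j , i)

  adjacent-sym : ∀ {p q} → Adjacent p q → Adjacent q p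
  adjacent-sym (diag-off i≢j) = off-diag i≢j
  adjacent-sym (off-diag i≢j) = diag-off i≢j
  adjacent-sym (off-off i≢j)  = off-off (≢-sym i≢j)

  adjacent-irrefl : ∀ {p} → ¬ Adjacent p p
  adjacent-irrefl (diag-off i≢j) = i≢j refl
  adjacent-irrefl (off-diag i≢j) = i≢j refl
  adjacent-irrefl (off-off i≢j)  = i≢j refl

  StableCells : (I × I → Bool) → Set
  StableCells s = ∀ {p q} → Adjacent p q → T (s p) → T (s q) → ⊥

  cross : I → List I → List (I × I)
  cross i []      = []
  cross i (j ∷ E) = (i , j) ∷ (j , i) ∷ cross i E

  square : List I → List (I × I)
  square []      = []
  square (i ∷ E) = (i , i) ∷ cross i E ++ square E

  triangle : ℕ → ℕ
  triangle zero    = 0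
  triangle (suc k) = k ℕ.+ triangle k

  diagonal : (I × I → Bool) → I → Bool
  diagonal s i = s (i , i)

  count-square : ∀ s i E → count s (square (i ∷ E)) ≡
                 ⟦ s (i , i) ⟧ ℕ.+ (count s (cross i E) ℕ.+ count s (square E))
  count-square s i E = cong (⟦ s (i , i) ⟧ ℕ.+_) (count-++ s (cross i E) (square E))

  module _ {s : I × I → Bool} (stable : StableCells s) where

    cross-bound : ∀ i E → All (i ≢_) E → count s (cross i E) ℕ.≤ length E
    cross-bound i []      _            = z≤n
    cross-bound i (j ∷ E) (i≢j ∷ i∉E) =
      subst (ℕ._≤ suc (length E)) (ℕ.+-assoc ⟦ s (i , j) ⟧ ⟦ s (j , i) ⟧ _)
        (ℕ.+-mono-≤ edge (cross-bound i E i∉E))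
      where
      edge : ⟦ s (i , j) ⟧ ℕ.+ ⟦ s (j , i) ⟧ ℕ.≤ 1
      edge with s (i , j) | s (j , i) | stable (off-off i≢j)
      ... | true  | true  | h = contradiction tt (h tt)
      ... | true  | false | _ = s≤s z≤n
      ... | false | true  | _ = s≤s z≤n
      ... | false | false | _ = z≤n

    cross-bound-selected : ∀ i E → All (i ≢_) E → T (s (i , i)) →
                           count s (cross i E) ℕ.+ count (diagonal s) E ℕ.≤ length E
    cross-bound-selected i []      _            _   = z≤n
    cross-bound-selected i (j ∷ E) (i≢j ∷ i∉E) sᵢᵢ =
      subst (ℕ._≤ suc (length E))
        (shuffle ⟦ s (i , j) ⟧ ⟦ s (j , i) ⟧ ⟦ s (j , j) ⟧ _ _)
        (ℕ.+-mono-≤ edge (cross-bound-selected i E i∉E sᵢᵢ))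
      where
      shuffle : ∀ a b c x y → (a ℕ.+ b ℕ.+ c) ℕ.+ (x ℕ.+ y) ≡ (a ℕ.+ (b ℕ.+ x)) ℕ.+ (c ℕ.+ y)
      shuffle = solve-∀
      edge : ⟦ s (i , j) ⟧ ℕ.+ ⟦ s (j , i) ⟧ ℕ.+ ⟦ s (j , j) ⟧ ℕ.≤ 1
      edge with s (i , j) | s (j , i) | s (j , j)
                | stable (diag-off i≢j) sᵢᵢ | stable (diag-off (≢-sym i≢j))
      ... | true  | _     | _     | h | _ = contradiction tt h
      ... | false | true  | true  | _ | h = contradiction tt (h tt)
      ... | false | true  | false | _ | _ = s≤s z≤n
      ... | false | false | true  | _ | _ = s≤s z≤n
      ... | false | false | false | _ | _ = z≤n

    square-bound : ∀ E → Unique E →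
      count s (square E) ℕ.≤ triangle (length E) ℕ.+ count (diagonal s) E ×
      count s (square E) ℕ.≤ triangle (length E) ℕ.+ 1
    square-bound []      _           = z≤n , z≤n
    square-bound (i ∷ E) (i∉E ∷ uE) =
      subst (ℕ._≤ suc-triangle ℕ.+ (⟦ s (i , i) ⟧ ℕ.+ p)) (sym (count-square s i E)) (proj₁ bounds) ,
      subst (ℕ._≤ suc-triangle ℕ.+ 1) (sym (count-square s i E)) (proj₂ bounds)
      where
      open ℕ.≤-Reasoning
      suc-triangle = triangle (suc (length E))
      k = length E
      t = triangle (length E)
      x = count s (cross i E)
      y = count s (square E)
      p = count (diagonal s) E
      IH = square-bound E uE
      rearrange₁ : ∀ k t p → 1 ℕ.+ (k ℕ.+ (t ℕ.+ p)) ≡ k ℕ.+ t ℕ.+ (1 ℕ.+ p)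
      rearrange₁ = solve-∀
      rearrange₂ : ∀ x t p → 1 ℕ.+ (x ℕ.+ (t ℕ.+ p)) ≡ (x ℕ.+ p) ℕ.+ t ℕ.+ 1
      rearrange₂ = solve-∀
      bounds : ⟦ s (i , i) ⟧ ℕ.+ (x ℕ.+ y) ℕ.≤ k ℕ.+ t ℕ.+ (⟦ s (i , i) ⟧ ℕ.+ p) ×
               ⟦ s (i , i) ⟧ ℕ.+ (x ℕ.+ y) ℕ.≤ k ℕ.+ t ℕ.+ 1
      bounds with s (i , i) | cross-bound-selected i E i∉E
      ... | true | x+p≤k =
        (begin
          1 ℕ.+ (x ℕ.+ y)             ≤⟨ ℕ.+-monoʳ-≤ 1 (ℕ.+-mono-≤ (cross-bound i E i∉E) (proj₁ IH)) ⟩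
          1 ℕ.+ (k ℕ.+ (t ℕ.+ p))     ≡⟨ rearrange₁ k t p ⟩
          k ℕ.+ t ℕ.+ (1 ℕ.+ p)       ∎) ,
        (begin
          1 ℕ.+ (x ℕ.+ y)             ≤⟨ ℕ.+-monoʳ-≤ 1 (ℕ.+-monoʳ-≤ x (proj₁ IH)) ⟩
          1 ℕ.+ (x ℕ.+ (t ℕ.+ p))     ≡⟨ rearrange₂ x t p ⟩
          (x ℕ.+ p) ℕ.+ t ℕ.+ 1       ≤⟨ ℕ.+-monoˡ-≤ 1 (ℕ.+-monoˡ-≤ t (x+p≤k tt)) ⟩
          k ℕ.+ t ℕ.+ 1               ∎)
      ... | false | _ =
        ℕ.≤-trans (ℕ.+-mono-≤ (cross-bound i E i∉E) (proj₁ IH)) (ℕ.≤-reflexive (sym (ℕ.+-assoc k t p))) ,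
        ℕ.≤-trans (ℕ.+-mono-≤ (cross-bound i E i∉E) (proj₂ IH)) (ℕ.≤-reflexive (sym (ℕ.+-assoc k t 1)))

T⇒1≤⟦⟧ : ∀ {x} → T x → 1 ℕ.≤ ⟦ x ⟧
T⇒1≤⟦⟧ {true} _ = ℕ.≤-refl

module _ {m} (b : Subset m) where

  cells : Fin m × Fin m → Bool
  cells (i , j) with i Fin.≟ j
  ... | yes _ = lookup b i
  ... | no  _ = not (lookup b i) ∧ (lookup b j ∨ (toℕ i ℕ.<ᵇ toℕ j))

  cells-diagonal : ∀ i → cells (i , i) ≡ lookup b i
  cells-diagonal i with i Fin.≟ i
  ... | yes _  = refl
  ... | no i≢i = contradiction refl i≢i

  cells-off-diagonal : ∀ {i j} → i ≢ j →
    cells (i , j) ≡ not (lookup b i) ∧ (lookup b j ∨ (toℕ i ℕ.<ᵇ toℕ j))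
  cells-off-diagonal {i} {j} i≢j with i Fin.≟ j
  ... | yes i≡j = contradiction i≡j i≢j
  ... | no _    = refl

  cells-stable : StableCells cells
  cells-stable (diag-off {i} {j} i≢j)
    rewrite cells-diagonal i | cells-off-diagonal i≢j = disjoint (lookup b i)
    where
    disjoint : ∀ x {y} → T x → T (not x ∧ y) → ⊥
    disjoint true _ ()
  cells-stable (off-diag i≢j) s t = cells-stable (diag-off i≢j) t s
  cells-stable (off-off {i} {j} i≢j)
    rewrite cells-off-diagonal i≢j | cells-off-diagonal (≢-sym i≢j)
    with lookup b i | lookup b j
  ... | false | true  = λ _ ()
  ... | true  | _     = λ ()
  ... | false | false = λ s t → ℕ.<-asym (ℕ.<ᵇ⇒< (toℕ i) (toℕ j) s) (ℕ.<ᵇ⇒< (toℕ j) (toℕ i) t)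

  cross-covered : ∀ {i j} → i ≢ j → ¬ (T (lookup b i) × T (lookup b j)) →
                  1 ℕ.≤ ⟦ cells (i , j) ⟧ ℕ.+ ⟦ cells (j , i) ⟧
  cross-covered {i} {j} i≢j
    rewrite cells-off-diagonal i≢j | cells-off-diagonal (≢-sym i≢j)
    with lookup b i | lookup b j
  ... | true  | true  = λ h → contradiction (tt , tt) h
  ... | true  | false = λ _ → s≤s z≤n
  ... | false | true  = λ _ → s≤s z≤n
  ... | false | false with ℕ.<-cmp (toℕ i) (toℕ j)
  ...   | tri< i<j _ _ = λ _ → ℕ.m≤n⇒m≤n+o _ (T⇒1≤⟦⟧ (ℕ.<⇒<ᵇ i<j))
  ...   | tri≈ _ i≡j _ = contradiction (Fin.toℕ-injective i≡j) i≢j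
  ...   | tri> _ _ j<i = λ _ → ℕ.m≤n⇒m≤o+n ⟦ toℕ i ℕ.<ᵇ toℕ j ⟧ (T⇒1≤⟦⟧ (ℕ.<⇒<ᵇ j<i))

  cross-count : ∀ i E → All (i ≢_) E → ⟦ lookup b i ⟧ ℕ.+ count (lookup b) E ℕ.≤ 1 →
                length E ℕ.≤ count cells (cross i E)
  cross-count i []      _            _ = z≤n
  cross-count i (j ∷ E) (i≢j ∷ i∉E) h =
    subst (suc (length E) ℕ.≤_) (ℕ.+-assoc ⟦ cells (i , j) ⟧ ⟦ cells (j , i) ⟧ _)
      (ℕ.+-mono-≤ (cross-covered i≢j one) (cross-count i E i∉E
        (ℕ.≤-trans (ℕ.+-monoʳ-≤ ⟦ lookup b i ⟧ (ℕ.m≤n+m (count (lookup b) E) ⟦ lookup b j ⟧)) h)))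
    where
    one : ¬ (T (lookup b i) × T (lookup b j))
    one (p , q) = ℕ.<⇒≱ (ℕ.+-mono-≤ (T⇒1≤⟦⟧ p) (ℕ.m≤n⇒m≤n+o (count (lookup b) E) (T⇒1≤⟦⟧ q))) h

  square-count : ∀ E → Unique E → count (lookup b) E ℕ.≤ 1 →
                 triangle {Fin m} (length E) ℕ.+ count (lookup b) E ℕ.≤ count cells (square E)
  square-count []      _           _ = z≤n
  square-count (i ∷ E) (i∉E ∷ uE) h = begin
    k ℕ.+ t ℕ.+ (⟦ lookup b i ⟧ ℕ.+ p)
      ≡⟨ rearrange k t ⟦ lookup b i ⟧ p ⟩
    ⟦ lookup b i ⟧ ℕ.+ (k ℕ.+ (t ℕ.+ p))
      ≤⟨ ℕ.+-mono-≤ (ℕ.≤-reflexive (cong ⟦_⟧ (sym (cells-diagonal i))))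
           (ℕ.+-mono-≤ (cross-count i E i∉E h)
             (square-count E uE (ℕ.≤-trans (ℕ.m≤n+m p ⟦ lookup b i ⟧) h))) ⟩
    ⟦ cells (i , i) ⟧ ℕ.+ (count cells (cross i E) ℕ.+ count cells (square E))
      ≡⟨ count-square cells i E ⟨
    count cells (square (i ∷ E)) ∎
    where
    open ℕ.≤-Reasoning
    k = length E
    t = triangle {Fin m} (length E)
    p = count (lookup b) E
    rearrange : ∀ k t x p → k ℕ.+ t ℕ.+ (x ℕ.+ p) ≡ x ℕ.+ (k ℕ.+ (t ℕ.+ p))
    rearrange = solve-∀

elements : ∀ {m} → Subset m → List (Fin m)
elements []          = []
elements (true  ∷ a) = zero ∷ List.map suc (elements a)
elements (false ∷ a) = List.map suc (elements a)

elements-unique : ∀ {m} (a : Subset m) → Unique (elements a)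
elements-unique []          = []
elements-unique (true  ∷ a) =
  All.map⁺ (All.universal (λ _ ()) (elements a)) ∷ Unique.map⁺ Fin.suc-injective (elements-unique a)
elements-unique (false ∷ a) = Unique.map⁺ Fin.suc-injective (elements-unique a)

count-elements : ∀ {m} (a b : Subset m) → count (lookup b) (elements a) ≡ card (a ∩ b)
count-elements []          []          = refl
count-elements (true ∷ a)  (true ∷ b)  =
  cong suc (trans (count-map (lookup (true ∷ b)) suc (elements a)) (count-elements a b))
count-elements (true ∷ a)  (false ∷ b) =
  trans (count-map (lookup (false ∷ b)) suc (elements a)) (count-elements a b)
count-elements (false ∷ a) (y ∷ b)     =
  trans (count-map (lookup (y ∷ b)) suc (elements a)) (count-elements a b)

rhs : ∀ {m} → Subset m → ℕ
rhs {m} a = triangle {Fin m} (length (elements a)) ℕ.+ 1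

cells-tight : ∀ {m} (a b : Subset m) → card (a ∩ b) ≡ 1 →
              count (cells b) (square (elements a)) ≡ rhs a
cells-tight {m} a b ∣a∩b∣≡1 = ℕ.≤-antisym
  (proj₂ (square-bound (cells-stable b) (elements a) (elements-unique a)))
  (subst (λ k → triangle {Fin m} (length (elements a)) ℕ.+ k ℕ.≤ count (cells b) (square (elements a)))
    one (square-count b (elements a) (elements-unique a) (ℕ.≤-reflexive one)))
  where
  one : count (lookup b) (elements a) ≡ 1
  one = trans (count-elements a b) ∣a∩b∣≡1

cells-slack : ∀ {m} (a b : Subset m) → card (a ∩ b) ≡ 0 →
              count (cells b) (square (elements a)) ℕ.< rhs a
cells-slack {m} a b ∣a∩b∣≡0 = begin-strict
  count (cells b) (square (elements a))
    ≤⟨ proj₁ (square-bound (cells-stable b) (elements a) (elements-unique a)) ⟩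
  t ℕ.+ count (diagonal (cells b)) (elements a)
    ≡⟨ cong (t ℕ.+_) (trans (count-cong (cells-diagonal b) (elements a)) (trans (count-elements a b) ∣a∩b∣≡0)) ⟩
  t ℕ.+ 0
    <⟨ ℕ.+-monoʳ-< t (s≤s z≤n) ⟩
  t ℕ.+ 1 ∎
  where
  open ℕ.≤-Reasoning
  t = triangle {Fin m} (length (elements a))

module _ {n m : ℕ} (m²≤n : m ℕ.* m ℕ.≤ n) where

  vertex : Fin m × Fin m → Fin n
  vertex (i , j) = inject≤ (combine i j) m²≤n

  cell : Fin n → Maybe (Fin m × Fin m)
  cell v with toℕ v ℕ.<? m ℕ.* m
  ... | yes v<m² = just (remQuot m (fromℕ< v<m²))
  ... | no  _    = nothing

  cell-vertex : ∀ p → cell (vertex p) ≡ just p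
  cell-vertex (i , j) with toℕ (vertex (i , j)) ℕ.<? m ℕ.* m
  ... | yes v<m² = cong just (trans
    (cong (remQuot m) (Fin.toℕ-injective
      (trans (Fin.toℕ-fromℕ< v<m²) (Fin.toℕ-inject≤ (combine i j) m²≤n))))
    (Fin.remQuot-combine i j))
  ... | no v≮m² = contradiction
    (subst (ℕ._< m ℕ.* m) (sym (Fin.toℕ-inject≤ (combine i j) m²≤n)) (Fin.toℕ<n (combine i j))) v≮m²

  data _~_ (u v : Fin n) : Set where
    edge : ∀ {p q} → cell u ≡ just p → cell v ≡ just q → Adjacent p q → u ~ v

  adjacent? : (p q : Fin m × Fin m) → Dec (Adjacent p q)
  adjacent? (i , j) (k , l) with i Fin.≟ k | i Fin.≟ j | k Fin.≟ l | j Fin.≟ k | i Fin.≟ l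
  ... | yes refl | yes refl | no i≢l   | _        | _        = yes (diag-off i≢l)
  ... | yes refl | no i≢j   | yes refl | _        | _        = yes (off-diag i≢j)
  ... | _        | no i≢j   | _        | yes refl | yes refl = yes (off-off i≢j)
  ... | yes refl | yes refl | yes refl | _        | _        = no adjacent-irrefl
  ... | yes refl | no i≢j   | no k≢l   | _        | no i≢l   =
    no λ { (diag-off _) → i≢j refl ; (off-diag _) → k≢l refl ; (off-off _) → i≢l refl }
  ... | yes refl | no i≢j   | no k≢l   | no j≢k   | yes refl = contradiction refl k≢l
  ... | no i≢k   | yes refl | _        | _        | _        =
    no λ { (diag-off _) → i≢k refl ; (off-diag _) → i≢k refl ; (off-off i≢j) → i≢j refl }
  ... | no i≢k   | no _     | _        | no j≢k   | _        =
    no λ { (diag-off _) → i≢k refl ; (off-diag _) → i≢k refl ; (off-off _) → j≢k refl }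
  ... | no i≢k   | no _     | _        | yes _    | no i≢l   =
    no λ { (diag-off _) → i≢k refl ; (off-diag _) → i≢k refl ; (off-off _) → i≢l refl }

  subdividedComplete : Graph n
  subdividedComplete = record
    { _~_      = _~_
    ; _~?_     = decide
    ; ~-sym    = λ { (edge p q adj) → edge q p (adjacent-sym adj) }
    ; ~-irrefl = λ { refl (edge p q adj) →
        adjacent-irrefl (subst (Adjacent _) (just-injective (trans (sym q) p)) adj) }
    }
    where
    decide : ∀ u v → Dec (u ~ v)
    decide u v with cell u in eqᵤ | cell v in eqᵥ
    ... | nothing | _       = no λ { (edge p _ _) → contradiction (trans (sym eqᵤ) p) λ () }
    ... | just _  | nothing = no λ { (edge _ q _) → contradiction (trans (sym eqᵥ) q) λ () }
    ... | just p  | just q  with adjacent? p q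
    ...   | yes adj = yes (edge eqᵤ eqᵥ adj)
    ...   | no ¬adj = no λ { (edge p′ q′ adj) → ¬adj
      (subst₂ Adjacent (just-injective (trans (sym p′) eqᵤ)) (just-injective (trans (sym q′) eqᵥ)) adj) }

  stable⇒stableCells : ∀ {S} → Stable subdividedComplete S → StableCells (lookup S ∘ vertex)
  stable⇒stableCells {S} stable {p} {q} adj s t =
    stable (selected p s) (selected q t) (edge (cell-vertex p) (cell-vertex q) adj)
    where
    selected : ∀ p → T (lookup S (vertex p)) → vertex p ∈ S
    selected p t = Vec.lookup⇒[]= (vertex p) S (Bool.T-≡ .Equivalence.to t)

  stableSet : Subset m → Subset n
  stableSet b = tabulate (maybe′ (cells b) false ∘ cell)

  stableSet-vertex : ∀ b p → lookup (stableSet b) (vertex p) ≡ cells b p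
  stableSet-vertex b p = trans (Vec.lookup∘tabulate _ (vertex p)) (cong (maybe′ (cells b) false) (cell-vertex p))

  stableSet-stable : ∀ b → Stable subdividedComplete (stableSet b)
  stableSet-stable b {u} {v} u∈S v∈S (edge p q adj) = cells-stable b adj (selected u p u∈S) (selected v q v∈S)
    where
    selected : ∀ u {p} → cell u ≡ just p → u ∈ stableSet b → T (cells b p)
    selected u eq u∈S = subst T
      (trans (sym (Vec.[]=⇒lookup u∈S)) (trans (Vec.lookup∘tabulate _ u) (cong (maybe′ (cells b) false) eq))) tt

-- Extended formulations of the stable set polytope

¬¬-∀Fin : ∀ {n} {P : Fin n → Set} → (∀ i → ¬ ¬ P i) → ¬ ¬ (∀ i → P i)
¬¬-∀Fin = Fin.sequence (RawMonad.rawApplicative (¬¬-Monad {0ℓ}))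

¬¬-∀Subset : ∀ {m} {P : Subset m → Set} → (∀ a → ¬ ¬ P a) → ¬ ¬ (∀ a → P a)
¬¬-∀Subset {zero}  h k = h [] λ p → k λ { [] → p }
¬¬-∀Subset {suc m} h k =
  ¬¬-∀Subset (h ∘ (true ∷_)) λ p → ¬¬-∀Subset (h ∘ (false ∷_)) λ q →
  k λ { (true ∷ a) → p a ; (false ∷ a) → q a }

module _ {n m k : ℕ} (m²≤n : m ℕ.* m ℕ.≤ n) where

  cellsOf : Subset m → List (Fin n)
  cellsOf a = List.map (vertex m²≤n) (square (elements a))

  count-stableSet : ∀ a b → count (lookup (stableSet m²≤n b)) (cellsOf a) ≡
                            count (cells b) (square (elements a))
  count-stableSet a b = trans
    (count-map (lookup (stableSet m²≤n b)) (vertex m²≤n) (square (elements a)))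
    (count-cong (stableSet-vertex m²≤n b) (square (elements a)))

  cellsOf-valid : ∀ a S → Stable (subdividedComplete m²≤n) S → count (lookup S) (cellsOf a) ℕ.≤ rhs a
  cellsOf-valid a S stable = subst (ℕ._≤ rhs a)
    (sym (count-map (lookup S) (vertex m²≤n) (square (elements a))))
    (proj₂ (square-bound (stable⇒stableCells m²≤n stable) (elements a) (elements-unique a)))

  module _ (Q : System n k) (ef : Q IsExtendedFormulationOf STAB (subdividedComplete {m = m} m²≤n)) where
    open System Q

    value : Subset m → Fin #ineq → ℝ
    value b = activity (subdividedComplete m²≤n) Q ef (stableSet-stable m²≤n b)

    -- The index zero stands for an extra rectangle, which takes care of a = ∅:
    -- no c has |∅ ∩ c| = 1.
    Positive : Fin (suc #ineq) → Subset m → Set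
    Positive zero    b = ⊤
    Positive (suc i) b = value b i < g≤ i

    Avoiding : Fin (suc #ineq) → Subset m → Set
    Avoiding i a = ∀ c → card (a ∩ c) ≡ 1 → ¬ Positive i c

    ¬¬-covered : ∀ a b → card (a ∩ b) ≡ 0 → ¬ (∀ i → ¬ (Avoiding i a × Positive i b))
    ¬¬-covered a b a∩b≡∅ none = none zero ((λ c₀ ∣a∩c₀∣≡1 _ → extrapolate c₀ ∣a∩c₀∣≡1) , tt)
      where
      extrapolate : ∀ c₀ → card (a ∩ c₀) ≡ 1 → ⊥
      extrapolate c₀ ∣a∩c₀∣≡1 = ¬¬-∀Fin witness λ w →
        no-extrapolation (subdividedComplete m²≤n) Q ef (cellsOf a) (rhs a) (cellsOf-valid a)
          (λ j → stableSet m²≤n (sets w j)) (λ j → stableSet-stable m²≤n (sets w j))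
          (subst (ℕ._< rhs a) (sym (count-stableSet a b)) (cells-slack a b a∩b≡∅))
          (λ j → trans (count-stableSet a (sets w (suc j))) (cells-tight a _ (sets-tight w j)))
          (λ i → proj₁ (proj₂ (proj₂ (w i))))
          (λ i → proj₁ (proj₂ (proj₂ (proj₂ (w i)))))
          (λ i → i , proj₂ (proj₂ (proj₂ (proj₂ (w i)))))
        where
        Witness : Fin #ineq → Set
        Witness i = ∃[ c ] card (a ∩ c) ≡ 1 ×
          ∃[ K ] 0ℚ ℚ.≤ K × fromℚ K ⊗ value c i ⊕ g≤ i ≤ fromℚ K ⊗ g≤ i ⊕ value b i

        witness : ∀ i → ¬ ¬ Witness i
        witness i ¬w = ¬w (c₀ , ∣a∩c₀∣≡1 , 1ℚ , ℚ.<⇒≤ 0<1ℚ , ⊕-mono-≤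
          (fromℚ-⊗-monoʳ-≤ (ℚ.<⇒≤ 0<1ℚ)
            (activity≤g (subdividedComplete m²≤n) Q ef (stableSet-stable m²≤n c₀) i))
          (≮⇒≥ λ positive → none (suc i)
            ( (λ c ∣a∩c∣≡1 c-positive → ¬w (c , ∣a∩c∣≡1 , archimedean (value b i) c-positive))
            , positive)))

        sets : (∀ i → Witness i) → Fin (suc (suc #ineq)) → Subset m
        sets w zero          = b
        sets w (suc zero)    = c₀
        sets w (suc (suc i)) = proj₁ (w i)

        sets-tight : ∀ w j → card (a ∩ sets w (suc j)) ≡ 1
        sets-tight w zero    = ∣a∩c₀∣≡1
        sets-tight w (suc i) = proj₁ (proj₂ (w i))

    size-bound : 3 ℕ.^ m ℕ.≤ suc #ineq ℕ.* 2 ℕ.^ m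
    size-bound = decidable-stable (3 ℕ.^ m ℕ.≤? suc #ineq ℕ.* 2 ℕ.^ m) λ ¬bound →
      ¬¬-∀Fin (λ i → ¬¬-∀Subset λ a → ¬¬-excluded-middle) λ avoiding? →
      ¬¬-∀Fin (λ i → ¬¬-∀Subset λ b → ¬¬-excluded-middle) λ positive? →
      ¬bound (bound avoiding? positive?)
      where
      bound : (∀ i a → Dec (Avoiding i a)) → (∀ i b → Dec (Positive i b)) →
              3 ℕ.^ m ℕ.≤ suc #ineq ℕ.* 2 ℕ.^ m
      bound avoiding? positive? = cover-bound (suc #ineq)
        (λ i a → ⌊ avoiding? i a ⌋) (λ i b → ⌊ positive? i b ⌋)
        (λ i a b p q ∣a∩b∣≡1 → toWitness p b ∣a∩b∣≡1 (toWitness q))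
        cover
        where
        cover : ∀ a b → card (a ∩ b) ≡ 0 → _
        cover a b a∩b≡∅ with Fin.any? (λ i → avoiding? i a ×-dec positive? i b)
        ... | yes (i , p , q) = i , fromWitness p , fromWitness q
        ... | no none = contradiction (λ i pq → none (i , pq)) (¬¬-covered a b a∩b≡∅)

√-seq≤1+⌊√n⌋ : ∀ n j → √-seq n j ℚ.≤ (+ suc ⌊√ n ⌋) ℚ./ 1
√-seq≤1+⌊√n⌋ n j = ℚ.toℚᵘ-cancel-≤ (begin
  ℚ.toℚᵘ (√-seq n j)                ≃⟨ ℚ.toℚᵘ-fromℚᵘ (mkℚᵘ (+ a) j) ⟩
  mkℚᵘ (+ a) j                      ≤⟨ *≤* (subst₂ ℤ._≤_ (ℤ.pos-* a 1) (ℤ.pos-* (suc s) J)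
                                         (ℤ.+≤+ (subst (ℕ._≤ suc s ℕ.* J) (sym (ℕ.*-identityʳ a)) a≤))) ⟩
  mkℚᵘ (+ suc s) 0                  ≃⟨ ℚ.toℚᵘ-fromℚᵘ (mkℚᵘ (+ suc s) 0) ⟨
  ℚ.toℚᵘ ((+ suc s) ℚ./ 1)          ∎)
  where
  open ℚᵘ.≤-Reasoning
  J = suc j
  s = ⌊√ n ⌋
  a = ⌊√ n ℕ.* (J ℕ.* J) ⌋
  square-* : ∀ s J → (s ℕ.* s) ℕ.* (J ℕ.* J) ≡ (s ℕ.* J) ℕ.* (s ℕ.* J)
  square-* = solve-∀
  squares : a ℕ.* a ℕ.≤ (suc s ℕ.* J) ℕ.* (suc s ℕ.* J)
  squares = ℕ.≤-trans (⌊√n⌋²≤n (n ℕ.* (J ℕ.* J)))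
    (subst (n ℕ.* (J ℕ.* J) ℕ.≤_) (square-* (suc s) J) (ℕ.*-monoˡ-≤ (J ℕ.* J) (ℕ.<⇒≤ (n<[1+⌊√n⌋]² n))))
  a≤ : a ℕ.≤ suc s ℕ.* J
  a≤ = ℕ.≮⇒≥ λ gt → ℕ.<⇒≱ (ℕ.*-mono-< gt gt) squares

exponent-bound : ∀ n a b .{{_ : NonZero b}} → fromℚ ((+ a) ℚ./ b) ≤ fromℚ ((+ 1) ℚ./ 8) * √ n →
                 8 ℕ.* a ℕ.≤ suc ⌊√ n ⌋ ℕ.* b
exponent-bound n a b@(suc b-1) h = subst₂ ℕ._≤_ (ℕ.*-comm a 8) refl
    (ℤ.drop‿+≤+ (subst₂ ℤ._≤_ (sym (ℤ.pos-* a 8)) (right s b) (ℚᵘ.drop-*≤* toℚᵘ-bound)))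
  where
  s = suc ⌊√ n ⌋
  ℚ-bound : (+ a) ℚ./ b ℚ.≤ (+ 1) ℚ./ 8 ℚ.* ((+ s) ℚ./ 1)
  ℚ-bound = fromℚ-cancel-≤ (≤-trans {fromℚ ((+ a) ℚ./ b)} {fromℚ ((+ 1) ℚ./ 8) * √ n} h
    (≤-pointwise λ j → ℚ.*-monoˡ-≤-nonNeg ((+ 1) ℚ./ 8) (√-seq≤1+⌊√n⌋ n j)))
  toℚᵘ-bound : mkℚᵘ (+ a) b-1 ℚᵘ.≤ mkℚᵘ (+ 1) 7 ℚᵘ.* mkℚᵘ (+ s) 0
  toℚᵘ-bound = begin
    mkℚᵘ (+ a) b-1                                    ≃⟨ ℚ.toℚᵘ-fromℚᵘ (mkℚᵘ (+ a) b-1) ⟨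
    ℚ.toℚᵘ ((+ a) ℚ./ b)                              ≤⟨ ℚ.toℚᵘ-mono-≤ ℚ-bound ⟩
    ℚ.toℚᵘ ((+ 1) ℚ./ 8 ℚ.* ((+ s) ℚ./ 1))            ≃⟨ ℚ.toℚᵘ-homo-* ((+ 1) ℚ./ 8) ((+ s) ℚ./ 1) ⟩
    ℚ.toℚᵘ ((+ 1) ℚ./ 8) ℚᵘ.* ℚ.toℚᵘ ((+ s) ℚ./ 1)    ≃⟨ ℚᵘ.*-congˡ {mkℚᵘ (+ 1) 7} (ℚ.toℚᵘ-fromℚᵘ (mkℚᵘ (+ s) 0)) ⟩
    mkℚᵘ (+ 1) 7 ℚᵘ.* mkℚᵘ (+ s) 0                    ∎
    where open ℚᵘ.≤-Reasoning
  right : ∀ s b → (+ 1) ℤ.* (+ s) ℤ.* (+ b) ≡ + (s ℕ.* b)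
  right s b = trans (cong (ℤ._* (+ b)) (ℤ.*-identityˡ (+ s))) (sym (ℤ.pos-* s b))

3≤⌊√n⌋ : ∀ {n} → 9 ℕ.≤ n → 3 ℕ.≤ ⌊√ n ⌋
3≤⌊√n⌋ {n} 9≤n = ℕ.≮⇒≥ λ lt → ℕ.<⇒≱ (n<[1+⌊√n⌋]² n) (ℕ.≤-trans (ℕ.*-mono-≤ lt lt) 9≤n)

theorem10 : Σ[ G ∈ ((n : ℕ) .{{_ : NonZero n}} → Graph n) ]
    Σ[ c ∈ ℝ ] 0ℝ < c ×
    (∃[ n₀ ] ∀ n .{{_ : NonZero n}} → n₀ ℕ.≤ n →
    ∀ r → IsExtensionComplexity (STAB (G n)) r → 2^ c * √ n ≤ r)
theorem10 =
  (λ n → subdividedComplete (⌊√n⌋²≤n n))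
  , fromℚ ((+ 1) ℚ./ 8)
  , mk< ((+ 1) ℚ./ 8) (ℚ.positive⁻¹ ((+ 1) ℚ./ 8)) (0 , λ _ _ → ℚ.≤-reflexive (ℚ.+-identityˡ ((+ 1) ℚ./ 8)))
  , 9
  , λ { n 9≤n r ((_ , Q , ef , refl) , _) a b a/b≤c√n →
        3^m≤[1+r]2^m⇒2^a≤r^b {⌊√ n ⌋} {_} {a} {b} (3≤⌊√n⌋ 9≤n) (size-bound {m = ⌊√ n ⌋} (⌊√n⌋²≤n n) Q ef) (exponent-bound n a b a/b≤c√n) }
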